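{- There exist an $\mathcal L_0$-structure $\mathcal A$, with underlying set $A$, which is a model of $\mathrm{PA}_{\mathrm{smu}}^{ - }\cup\operatorname{Th}_{\forall}(\mathfrak N_0)$, and an element $d\in A$ such that, for every $a\in A$ and every $j\in\{0,1,2\}$, $$d\ne 3a+j$$ (where $3$, $j$, $+$ and multiplication are interpreted in $\mathcal A$).
   Context: The base language is $\mathcal L_0=\{0,1,+,\cdot,\le\}$ (first-order logic with equality). Abbreviations: $2:=1+1$; $3:=2+1$; $x<y$ means $x\le y\land x\ne y$; $x\mid y$ means $\exists z\,(z\cdot x=y)$; $\operatorname{pow}_2(x)$ means $\forall y\,(y\mid x\rightarrow(y=1\lor 2\mid y))$. $\mathrm{PA}_{\mathrm{smu}}^{ - }$ is the $\mathcal L_0$-theory whose axioms are the universal closures of: (pa1) $x+0=x$; (pa2) $x+y=y+x$; (pa3) $(x+y)+z=x+(y+z)$; (pa4) $x\cdot1=x$; (pa5) $x\cdot y=y\cdot x$; (pa6) $(x\cdot y)\cdot z=x\cdot(y\cdot z)$; (pa7) $x\cdot(y+z)=x\cdot y+x\cdot z$; (pa8) $x\le y\lor y\le x$; (pa9) $(x\le y\land y\le z)\rightarrow x\le z$; (pa10) $\neg(x+1\le x)$; (pa11) $y\le x\rightarrow(y=x\lor y+1\le x)$; (pa12) $y\le x\rightarrow y+z\le x+z$; (pa13) $y\le x\rightarrow y\cdot z\le x\cdot z$; (pa15) $y\le x\rightarrow\exists z\,(x=y+z)$; (pa19) $\exists u\,(\operatorname{pow}_2(u)\land u\le x+1\land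 x+1<2\cdot u)$; (pa20) $(\operatorname{pow}_2(x)\land\operatorname{pow}_2(y)\land x\le y)\rightarrow x\mid y$. $\mathfrak N_0=(\mathbb N;0,1,+,\cdot,\le)$ is the standard model ($0\in\mathbb N$). $\operatorname{Th}_{\forall}(\mathfrak N_0)$ is the set of all universal $\mathcal L_0$-sentences (a block of universal quantifiers followed by a quantifier-free formula) true in $\mathfrak N_0$. -}

module Defs where

open import Data.Empty using (⊥)
open import Data.Fin using (Fin; suc)
open import Data.Fin.Patterns using (0F; 1F; 2F)
import Data.Nat as ℕ
open import Data.Nat using (ℕ; zero; suc)
open import Data.Product using (_×_; Σ)
open import Data.Sum using (_⊎_)
open import Data.Vec using (Vec; []; _∷_; lookup)
open import Level using (0ℓ)
open import Relation.Binary.PropositionalEquality using (_≡_)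
open import Relation.Unary using (Pred; _∈_)

infixl 8 _⊗_
infixl 7 _⊕_
infix  6 _≐_ _≼_ _≺_ _∣′_
infix  5 ¬′_ ∀′_ ∃′_
infixr 4 _∧′_
infixr 3 _∨′_
infixr 2 _⇒_

-- Terms and formulas are well-scoped de Bruijn syntax: the index counts the
-- free variables, and variable 0 is bound by the nearest quantifier.

data Term (n : ℕ) : Set where
  var     : Fin n → Term n
  𝟘 𝟙     : Term n
  _⊕_ _⊗_ : Term n → Term n → Term n

data Formula (n : ℕ) : Set where
  _≐_ _≼_        : Term n → Term n → Formula n
  ⊥′             : Formula n
  _∧′_ _∨′_ _⇒_ : Formula n → Formula n → Formula n
  ∀′_ ∃′_        : Formula (suc n) → Formula n

Sentence : Set
Sentence = Formula 0

Theory : Set₁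
Theory = Pred Sentence 0ℓ

weaken : ∀ {n} → Term n → Term (suc n)
weaken (var i) = var (suc i)
weaken 𝟘       = 𝟘
weaken 𝟙       = 𝟙
weaken (s ⊕ t) = weaken s ⊕ weaken t
weaken (s ⊗ t) = weaken s ⊗ weaken t

-- The clause for 1 makes the numerals 0, 1, 1 + 1, (1 + 1) + 1, …

numeral : ∀ {n} → ℕ → Term n
numeral zero          = 𝟘
numeral (suc zero)    = 𝟙
numeral (suc (suc k)) = numeral (suc k) ⊕ 𝟙

¬′_ : ∀ {n} → Formula n → Formula n
¬′ φ = φ ⇒ ⊥′

_≺_ : ∀ {n} → Term n → Term n → Formula n
s ≺ t = s ≼ t ∧′ ¬′ (s ≐ t)

_∣′_ : ∀ {n} → Term n → Term n → Formula n
s ∣′ t = ∃′ (var 0F ⊗ weaken s ≐ weaken t)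

pow₂ : ∀ {n} → Term n → Formula n
pow₂ t = ∀′ (var 0F ∣′ weaken t ⇒ var 0F ≐ 𝟙 ∨′ numeral 2 ∣′ var 0F)

closure : ∀ {n} → Formula n → Sentence
closure {zero}  φ = φ
closure {suc n} φ = closure (∀′ φ)

data QuantifierFree {n : ℕ} : Pred (Formula n) 0ℓ where
  _≐_ : ∀ s t → QuantifierFree (s ≐ t)
  _≼_ : ∀ s t → QuantifierFree (s ≼ t)
  ⊥′  : QuantifierFree ⊥′
  _∧′_ : ∀ {φ ψ} → QuantifierFree φ → QuantifierFree ψ → QuantifierFree (φ ∧′ ψ)
  _∨′_ : ∀ {φ ψ} → QuantifierFree φ → QuantifierFree ψ → QuantifierFree (φ ∨′ ψ)
  _⇒_ : ∀ {φ ψ} → QuantifierFree φ → QuantifierFree ψ → QuantifierFree (φ ⇒ ψ)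

data Universal : Pred Sentence 0ℓ where
  universal : ∀ {n} {φ : Formula n} → QuantifierFree φ → Universal (closure φ)

record Structure : Set₁ where
  infixl 7 _*_
  infixl 6 _+_
  infix  4 _≤_
  field
    Carrier : Set
    0# 1#   : Carrier
    _+_ _*_ : Carrier → Carrier → Carrier
    _≤_     : Carrier → Carrier → Set

-- Equality is interpreted as propositional equality of the carrier, and the
-- logical symbols by the corresponding type formers, so a disjunction or an
-- existential holds only with a witness.

module _ (𝔄 : Structure) where
  open Structure 𝔄

  eval : ∀ {n} → Vec Carrier n → Term n → Carrier
  eval ρ (var i) = lookup ρ i
  eval ρ 𝟘       = 0#
  eval ρ 𝟙       = 1#
  eval ρ (s ⊕ t) = eval ρ s + eval ρ t
  eval ρ (s ⊗ t) = eval ρ s * eval ρ t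

  Satisfies : ∀ {n} → Vec Carrier n → Formula n → Set
  Satisfies ρ (s ≐ t)  = eval ρ s ≡ eval ρ t
  Satisfies ρ (s ≼ t)  = eval ρ s ≤ eval ρ t
  Satisfies ρ ⊥′       = ⊥
  Satisfies ρ (φ ∧′ ψ) = Satisfies ρ φ × Satisfies ρ ψ
  Satisfies ρ (φ ∨′ ψ) = Satisfies ρ φ ⊎ Satisfies ρ ψ
  Satisfies ρ (φ ⇒ ψ)  = Satisfies ρ φ → Satisfies ρ ψ
  Satisfies ρ (∀′ φ)   = ∀ a → Satisfies (a ∷ ρ) φ
  Satisfies ρ (∃′ φ)   = Σ Carrier λ a → Satisfies (a ∷ ρ) φ

infix 4 _⊨_ _⊨ᵀ_

_⊨_ : Structure → Sentence → Set
𝔄 ⊨ φ = Satisfies 𝔄 [] φ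

_⊨ᵀ_ : Structure → Theory → Set
𝔄 ⊨ᵀ T = ∀ {φ} → φ ∈ T → 𝔄 ⊨ φ

𝔑₀ : Structure
𝔑₀ = record
  { Carrier = ℕ
  ; 0#      = 0
  ; 1#      = 1
  ; _+_     = ℕ._+_
  ; _*_     = ℕ._*_
  ; _≤_     = ℕ._≤_
  }

-- Atomic formulas are decidable in 𝔑₀, so for universal sentences 𝔑₀ ⊨ φ
-- agrees with classical truth.

Th∀ : Structure → Theory
Th∀ 𝔄 φ = Universal φ × 𝔄 ⊨ φ

private
  x : ∀ {n} → Term (1 ℕ.+ n)
  x = var 0F

  y : ∀ {n} → Term (2 ℕ.+ n)
  y = var 1F

  z : ∀ {n} → Term (3 ℕ.+ n)
  z = var 2F

-- Under ∃′ the witness is var 0F, and x, y must be weakened.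

data PA⁻smu : Theory where
  pa1  : PA⁻smu (closure {1} (x ⊕ 𝟘 ≐ x))
  pa2  : PA⁻smu (closure {2} (x ⊕ y ≐ y ⊕ x))
  pa3  : PA⁻smu (closure {3} ((x ⊕ y) ⊕ z ≐ x ⊕ (y ⊕ z)))
  pa4  : PA⁻smu (closure {1} (x ⊗ 𝟙 ≐ x))
  pa5  : PA⁻smu (closure {2} (x ⊗ y ≐ y ⊗ x))
  pa6  : PA⁻smu (closure {3} ((x ⊗ y) ⊗ z ≐ x ⊗ (y ⊗ z)))
  pa7  : PA⁻smu (closure {3} (x ⊗ (y ⊕ z) ≐ x ⊗ y ⊕ x ⊗ z))
  pa8  : PA⁻smu (closure {2} (x ≼ y ∨′ y ≼ x))
  pa9  : PA⁻smu (closure {3} (x ≼ y ∧′ y ≼ z ⇒ x ≼ z))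
  pa10 : PA⁻smu (closure {1} (¬′ (x ⊕ 𝟙 ≼ x)))
  pa11 : PA⁻smu (closure {2} (y ≼ x ⇒ y ≐ x ∨′ y ⊕ 𝟙 ≼ x))
  pa12 : PA⁻smu (closure {3} (y ≼ x ⇒ y ⊕ z ≼ x ⊕ z))
  pa13 : PA⁻smu (closure {3} (y ≼ x ⇒ y ⊗ z ≼ x ⊗ z))
  pa15 : PA⁻smu (closure {2} (y ≼ x ⇒ ∃′ (weaken x ≐ weaken y ⊕ var 0F)))
  pa19 : PA⁻smu (closure {1}
           (∃′ (pow₂ (var 0F) ∧′ var 0F ≼ weaken x ⊕ 𝟙
                              ∧′ weaken x ⊕ 𝟙 ≺ numeral 2 ⊗ var 0F)))
  pa20 : PA⁻smu (closure {2} (pow₂ x ∧′ pow₂ y ∧′ x ≼ y ⇒ x ∣′ y))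

{-# OPTIONS --safe #-}

-- Take the polynomials c + (X / 2ᵗ) r(X) with c an integer and r an integer polynomial, ordered by
-- their eventual values at X = 2ᵏ; the model consists of the nonnegative ones. Any two of them compare
-- in one way for all large k, so quantifier-free facts about ℕ hold of the polynomials because they
-- hold at every single k; this covers Th∀ 𝔑₀ and all axioms without existential quantifiers. A
-- polynomial whose values are eventually even can be halved, so the model contains 2ᵉ Xᵐ for every
-- integer e if m ≥ 1. These and the powers of two in ℕ divide each other as pa20 demands and reach
-- every nonzero element up to a factor of two; any other element has an odd divisor different from 1, so it
-- does not satisfy pow₂. Finally X is not of the form 3a + j: doubling 2ᵏ = 3a + j shows that 3 ∣ j.

module Submission where

import Algebra.Bundles
import Data.Integer.DivMod as ℤD
import Data.Integer.Properties as ℤₚ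
import Data.Nat as ℕ
import Data.Nat.Properties as ℕₚ
import Data.Sum as Sum
open import Algebra.Properties.Group (Algebra.Bundles.AbelianGroup.group ℤₚ.+-0-abelianGroup)
  using () renaming (∙-cancelˡ to +-cancelˡ)
open import Axiom.UniquenessOfIdentityProofs.WithK using (uip)
open import Data.Bool using (Bool; true; false)
open import Data.Empty using (⊥; ⊥-elim)
open import Data.Fin using (Fin; toℕ)
open import Data.Fin.Patterns using (0F)
open import Data.Integer as ℤ using (ℤ; +_; -[1+_]; 0ℤ; 1ℤ; ∣_∣; +<+; -<+)
open import Data.Integer.Divisibility.Signed using (divides) renaming (_∣?_ to _∣ℤ?_)
open import Data.Integer.Tactic.RingSolver using (solve)
open import Data.List using (List; []; _∷_; map)
open import Data.List.Properties using (map-id; map-∘; map-cong; map-injective)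
open import Data.Nat using (ℕ; zero; suc; _+_; _*_; _^_; _∸_; _⊔_; _≤_; _<_; z≤n; s≤s; NonZero)
open import Data.Nat.Divisibility using (divides; _∣_; _∣?_; ∣m∣n⇒∣m+n; ∣m+n∣m⇒∣n; m∣m*n)
open import Data.Nat.DivMod using (_/_; m*[n/m]≡n)
open import Data.Nat.Primality using (prime[2]; prime?; euclidsLemma)
open import Data.Nat.Tactic.RingSolver using (solve-∀)
open import Data.Product using (Σ; _×_; _,_; proj₁; proj₂; ∃; ∃-syntax)
open import Data.Sum using (_⊎_; inj₁; inj₂)
open import Function using (_∘_; id)
open import Relation.Binary.Definitions using (tri<; tri≈; tri>)
open import Relation.Binary.PropositionalEquality
open import Relation.Nullary using (¬_; Dec; yes; no; contradiction)
open import Relation.Nullary.Decidable using (map′; _×-dec_; from-yes; from-no)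
open import Relation.Unary using (_∪_)
open import Defs

-- Eventual signs and magnitudes

-- Holding for all large `k` can replace an ultrafilter because every comparison made below is
-- eventually constant. The explicit threshold lets a concrete `k` be extracted.
record Eventually (P : ℕ → Set) : Set where
  constructor from_,_
  field
    start : ℕ
    holds : ∀ k → start ≤ k → P k

private
  variable
    P Q R : ℕ → Set

always : (∀ k → P k) → Eventually P
always p = from 0 , λ k _ → p k

ev-map : (∀ k → P k → Q k) → Eventually P → Eventually Q
ev-map f (from K , p) = from K , λ k K≤k → f k (p k K≤k)

ev-zip : (∀ k → P k → Q k → R k) → Eventually P → Eventually Q → Eventually R
ev-zip f (from K , p) (from L , q) = from K ⊔ L , λ k le →
  f k (p k (ℕₚ.≤-trans (ℕₚ.m≤m⊔n K L) le)) (q k (ℕₚ.≤-trans (ℕₚ.m≤n⊔m K L) le))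

ev-and : Eventually P → Eventually Q → Eventually (λ k → P k × Q k)
ev-and = ev-zip (λ _ → _,_)

ev-witness : Eventually P → ∃ P
ev-witness (from K , p) = K , p K ℕₚ.≤-refl

ev-absurd : (∀ k → P k → Q k → ⊥) → Eventually P → Eventually Q → ⊥
ev-absurd f p q = proj₂ (ev-witness (ev-zip f p q))

ev-≥ : ∀ n → Eventually (n ≤_)
ev-≥ n = from n , λ _ le → le

n<2^n : ∀ n → n < 2 ^ n
n<2^n zero    = s≤s z≤n
n<2^n (suc n) = ℕₚ.+-mono-≤-< {1} (ℕₚ.m^n>0 2 n) (ℕₚ.<-≤-trans (n<2^n n) (ℕₚ.m≤m+n _ 0))

-- This makes a fixed coefficient negligible against the terms above it.
ev-2^ : ∀ s n → Eventually (λ k → n < 2 ^ (k ∸ s))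
ev-2^ s n = from n + s , λ k le → ℕₚ.<-≤-trans (n<2^n n)
  (ℕₚ.^-monoʳ-≤ 2 (ℕₚ.≤-trans (ℕₚ.≤-reflexive (sym (ℕₚ.m+n∸n≡m n s))) (ℕₚ.∸-monoˡ-≤ s le)))

-- Opaque, since integer products of unfolded powers reduce to terms that unification cannot match.
opaque
  pow : ℕ → ℤ
  pow k = + (2 ^ k)

  pow≡ : ∀ k → pow k ≡ + (2 ^ k)
  pow≡ k = refl

pow-+ : ∀ m n → pow (m + n) ≡ pow m ℤ.* pow n
pow-+ m n rewrite pow≡ (m + n) | pow≡ m | pow≡ n =
  trans (cong +_ (ℕₚ.^-distribˡ-+-* 2 m n)) (ℤₚ.pos-* (2 ^ m) (2 ^ n))

pow-suc : ∀ n → pow (suc n) ≡ + 2 ℤ.* pow n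
pow-suc n = trans (pow-+ 1 n) (cong (ℤ._* pow n) (pow≡ 1))

pow-split : ∀ {s k} → s ≤ k → pow k ≡ pow s ℤ.* pow (k ∸ s)
pow-split {s} {k} le = trans (cong pow (sym (ℕₚ.m+[n∸m]≡n le))) (pow-+ s (k ∸ s))

instance
  2^-nonZero : ∀ {k} → NonZero (2 ^ k)
  2^-nonZero {k} = ℕₚ.m^n≢0 2 k

opaque
  unfolding pow
  instance
    pow-positive : ∀ {k} → ℤ.Positive (pow k)
    pow-positive {k} = ℤ.positive (+<+ (ℕₚ.m^n>0 2 k))

    pow-nonZero : ∀ {k} → ℤ.NonZero (pow k)
    pow-nonZero {k} = 2^-nonZero {k}

    pow-nonNegative : ∀ {k} → ℤ.NonNegative (pow k)
    pow-nonNegative = ℤ.nonNegative (ℤ.+≤+ z≤n)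

  1≤pow : ∀ k → 1ℤ ℤ.≤ pow k
  1≤pow k = ℤ.+≤+ (ℕₚ.m^n>0 2 k)

∣i∣<n⇒i<n : ∀ i {n} → ∣ i ∣ < n → i ℤ.< + n
∣i∣<n⇒i<n (+ _)    lt = +<+ lt
∣i∣<n⇒i<n -[1+ _ ] lt = -<+

∣i∣<2^⇒i<pow : ∀ i {k} → ∣ i ∣ < 2 ^ k → i ℤ.< pow k
∣i∣<2^⇒i<pow i {k} lt = subst (i ℤ.<_) (sym (pow≡ k)) (∣i∣<n⇒i<n i lt)

∣i∣<2^⇒-pow<i : ∀ i {k} → ∣ i ∣ < 2 ^ k → ℤ.- (pow k) ℤ.< i
∣i∣<2^⇒-pow<i i {k} lt = subst (ℤ.- (pow k) ℤ.<_) (ℤₚ.neg-involutive i)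
  (ℤₚ.neg-mono-< (∣i∣<2^⇒i<pow (ℤ.- i) (subst (_< 2 ^ k) (sym (ℤₚ.∣-i∣≡∣i∣ i)) lt)))

log₂ : ∀ n → ∃[ b ] 2 ^ b ≤ suc n × suc n < 2 ^ suc b
log₂ zero = 0 , s≤s z≤n , s≤s (s≤s z≤n)
log₂ (suc n) with log₂ n
... | b , lo , hi with suc (suc n) ℕₚ.<? 2 ^ suc b
...   | yes lt = b , ℕₚ.m≤n⇒m≤1+n lo , lt
...   | no ≮ = suc b , ℕₚ.≮⇒≥ ≮ , ℕₚ.≤-<-trans hi (ℕₚ.^-monoʳ-< 2 (s≤s (s≤s z≤n)) (ℕₚ.n<1+n (suc b)))

-- The exact case is kept apart because only there does the sign of the next coefficient matter:
-- in magnitude-step a negative one pushes the value below the power of two.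
record Magnitude (f : ℕ → ℤ) : Set where
  constructor magnitude
  field
    m b t  : ℕ
    shape  : t ≡ 0 ⊎ 1 ≤ m
    bounds : Eventually (λ k → pow t ℤ.* f k ≡ pow (m * k + b))
           ⊎ Eventually (λ k → pow (m * k + b) ℤ.< pow t ℤ.* f k
                             × pow t ℤ.* f k ℤ.< + 2 ℤ.* pow (m * k + b))

magnitude-positive : ∀ {f} → Magnitude f → Eventually (λ k → 0ℤ ℤ.< f k)
magnitude-positive {f} (magnitude m b t _ bounds) = ev-map (λ k le →
    ℤₚ.*-cancelˡ-<-nonNeg {0ℤ} {f k} (pow t) (subst (ℤ._< pow t ℤ.* f k) (sym (ℤₚ.*-zeroʳ (pow t)))
      (ℤₚ.<-≤-trans (ℤₚ.positive⁻¹ (pow (m * k + b))) le))) (lower bounds)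
  where
  lower : _ → Eventually (λ k → pow (m * k + b) ℤ.≤ pow t ℤ.* f k)
  lower (inj₁ eq) = ev-map (λ _ e → ℤₚ.≤-reflexive (sym e)) eq
  lower (inj₂ lt) = ev-map (λ _ l → ℤₚ.<⇒≤ (proj₁ l)) lt

data Sign (f : ℕ → ℤ) : Set where
  vanishing : Eventually (λ k → f k ≡ 0ℤ) → Sign f
  negative  : Eventually (λ k → f k ℤ.< 0ℤ) → Sign f
  positive  : Magnitude f → Sign f

constant-sign : ∀ {f} c → Eventually (λ k → f k ≡ c) → Sign f
constant-sign (+ 0)     eq = vanishing eq
constant-sign -[1+ n ]  eq = negative (ev-map (λ _ e → subst (ℤ._< 0ℤ) (sym e) -<+) eq)
constant-sign {f} (+ suc n) eq with log₂ n
... | b , lo , hi = positive (magnitude 0 b 0 (inj₁ refl) bounds)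
  where
  1*f≡ : ∀ {k} → f k ≡ + suc n → pow 0 ℤ.* f k ≡ + suc n
  1*f≡ {k} e = trans (cong (ℤ._* f k) (pow≡ 0)) (trans (ℤₚ.*-identityˡ (f k)) e)
  bounds : Eventually (λ k → pow 0 ℤ.* f k ≡ pow b)
         ⊎ Eventually (λ k → pow b ℤ.< pow 0 ℤ.* f k × pow 0 ℤ.* f k ℤ.< + 2 ℤ.* pow b)
  bounds with 2 ^ b ℕₚ.≟ suc n
  ... | yes p = inj₁ (ev-map (λ k e → trans (1*f≡ e) (trans (cong +_ (sym p)) (sym (pow≡ b)))) eq)
  ... | no ≢  = inj₂ (ev-map (λ k e → subst (λ x → pow b ℤ.< x × x ℤ.< + 2 ℤ.* pow b) (sym (1*f≡ e))
        ( subst (ℤ._< + suc n) (sym (pow≡ b)) (+<+ (ℕₚ.≤∧≢⇒< lo ≢))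
        , subst (+ suc n ℤ.<_) (trans (sym (pow≡ (suc b))) (pow-suc b)) (+<+ hi))) eq)

-- Over the integers both strict inequalities have room 1: `B + 1 ≤ F` and `F + 1 ≤ 2B`. Multiplied
-- by `X`, this room absorbs any `S` with `-X < S < X`.
strict-bounds : ∀ S X B F → ℤ.- X ℤ.< S → S ℤ.< X → .{{ℤ.NonNegative X}} →
  B ℤ.< F → F ℤ.< + 2 ℤ.* B →
  X ℤ.* B ℤ.< S ℤ.+ X ℤ.* F × S ℤ.+ X ℤ.* F ℤ.< + 2 ℤ.* (X ℤ.* B)
strict-bounds S X B F -X<S S<X B<F F<2B = lower , upper
  where
  open ℤₚ.≤-Reasoning
  lower = begin-strict
    X ℤ.* B                     ≡⟨ solve (X ∷ B ∷ []) ⟩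
    ℤ.- X ℤ.+ X ℤ.* (1ℤ ℤ.+ B)  <⟨ ℤₚ.+-monoˡ-< _ -X<S ⟩
    S ℤ.+ X ℤ.* (1ℤ ℤ.+ B)      ≤⟨ ℤₚ.+-monoʳ-≤ S (ℤₚ.*-monoˡ-≤-nonNeg X (ℤₚ.i<j⇒suc[i]≤j B<F)) ⟩
    S ℤ.+ X ℤ.* F               ∎
  upper = begin-strict
    S ℤ.+ X ℤ.* F               <⟨ ℤₚ.+-monoˡ-< _ S<X ⟩
    X ℤ.+ X ℤ.* F               ≡⟨ solve (X ∷ F ∷ []) ⟩
    X ℤ.* (1ℤ ℤ.+ F)            ≤⟨ ℤₚ.*-monoˡ-≤-nonNeg X (ℤₚ.i<j⇒suc[i]≤j F<2B) ⟩
    X ℤ.* (+ 2 ℤ.* B)           ≡⟨ solve (X ∷ B ∷ []) ⟩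
    + 2 ℤ.* (X ℤ.* B)           ∎

positive-correction : ∀ S X B → 0ℤ ℤ.< S → S ℤ.< X → .{{ℤ.NonNegative X}} → 1ℤ ℤ.≤ B →
  X ℤ.* B ℤ.< S ℤ.+ X ℤ.* B × S ℤ.+ X ℤ.* B ℤ.< + 2 ℤ.* (X ℤ.* B)
positive-correction S X B 0<S S<X 1≤B =
  subst (ℤ._< S ℤ.+ X ℤ.* B) (ℤₚ.+-identityˡ _) (ℤₚ.+-monoˡ-< (X ℤ.* B) 0<S) , (begin-strict
    S ℤ.+ X ℤ.* B         <⟨ ℤₚ.+-monoˡ-< _ S<X ⟩
    X ℤ.+ X ℤ.* B         ≡⟨ solve (X ∷ B ∷ []) ⟩
    X ℤ.* 1ℤ ℤ.+ X ℤ.* B  ≤⟨ ℤₚ.+-monoˡ-≤ _ (ℤₚ.*-monoˡ-≤-nonNeg X 1≤B) ⟩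
    X ℤ.* B ℤ.+ X ℤ.* B   ≡⟨ solve (X ∷ B ∷ []) ⟩
    + 2 ℤ.* (X ℤ.* B)     ∎)
  where open ℤₚ.≤-Reasoning

-- The sum falls just below `X * B`. Doubling it makes `X * B` the lower bound again, which costs
-- one more factor of two in the scaling `t` of `magnitude-step`.
negative-correction : ∀ S X B → S ℤ.< 0ℤ → ℤ.- X ℤ.< + 2 ℤ.* S → .{{ℤ.NonNegative X}} → 1ℤ ℤ.≤ B →
  X ℤ.* B ℤ.< + 2 ℤ.* (S ℤ.+ X ℤ.* B) × + 2 ℤ.* (S ℤ.+ X ℤ.* B) ℤ.< + 2 ℤ.* (X ℤ.* B)
negative-correction S X B S<0 -X<2S 1≤B =
  (begin-strict
    X ℤ.* B                                       ≡⟨ solve (X ∷ B ∷ []) ⟩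
    ℤ.- X ℤ.+ (X ℤ.* 1ℤ ℤ.+ X ℤ.* B)              <⟨ ℤₚ.+-monoˡ-< _ -X<2S ⟩
    + 2 ℤ.* S ℤ.+ (X ℤ.* 1ℤ ℤ.+ X ℤ.* B)          ≤⟨ ℤₚ.+-monoʳ-≤ (+ 2 ℤ.* S) (ℤₚ.+-monoˡ-≤ _ (ℤₚ.*-monoˡ-≤-nonNeg X 1≤B)) ⟩
    + 2 ℤ.* S ℤ.+ (X ℤ.* B ℤ.+ X ℤ.* B)           ≡⟨ solve (S ∷ X ∷ B ∷ []) ⟩
    + 2 ℤ.* (S ℤ.+ X ℤ.* B)                       ∎) ,
  ℤₚ.*-monoˡ-<-pos (+ 2) (subst (S ℤ.+ X ℤ.* B ℤ.<_) (ℤₚ.+-identityˡ _) (ℤₚ.+-monoˡ-< (X ℤ.* B) S<0))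
  where open ℤₚ.≤-Reasoning

module _ {f : ℕ → ℤ} (s : ℕ) (c : ℤ) where

  private
    g : ℕ → ℤ
    g k = c ℤ.+ pow (k ∸ s) ℤ.* f k

    S : ℕ → ℤ
    S t = pow (t + s) ℤ.* c

    big : ∀ t → Eventually (λ k → s ≤ k × ∣ S t ∣ < 2 ^ k × ∣ + 2 ℤ.* S t ∣ < 2 ^ k)
    big t = ev-and (ev-≥ s) (ev-and (ev-2^ 0 _) (ev-2^ 0 _))

    scaled : ∀ t {k F} → s ≤ k → pow t ℤ.* f k ≡ F → S t ℤ.+ pow k ℤ.* F ≡ pow (t + s) ℤ.* g k
    scaled t {k} le refl = identity (pow t) (pow s) (pow (k ∸ s)) (f k) (pow-+ t s) (pow-split le)
      where
      identity : ∀ {p x} t s y f → p ≡ t ℤ.* s → x ≡ s ℤ.* y →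
        p ℤ.* c ℤ.+ x ℤ.* (t ℤ.* f) ≡ p ℤ.* (c ℤ.+ y ℤ.* f)
      identity t s y f refl refl = solve (t ∷ s ∷ c ∷ y ∷ f ∷ [])

    pow-suc-m : ∀ m b k → pow k ℤ.* pow (m * k + b) ≡ pow (suc m * k + b)
    pow-suc-m m b k = sym (trans (cong pow (ℕₚ.+-assoc k (m * k) b)) (pow-+ k (m * k + b)))

    Between : ℤ → ℤ → Set
    Between B F = B ℤ.< F × F ℤ.< + 2 ℤ.* B

  -- Scaling by `pow (t + s)` turns the factor `pow (k ∸ s)` into `pow k`, so `m` grows by one. The
  -- constant becomes `S t`, which is eventually smaller than `pow k` in absolute value.
  magnitude-step : Magnitude f → Magnitude g
  magnitude-step (magnitude m b t _ (inj₂ bounds)) =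
    magnitude (suc m) b (t + s) (inj₂ (s≤s z≤n)) (inj₂ (ev-zip
      (λ k (s≤k , small , _) (lo , hi) → subst₂ Between (pow-suc-m m b k) (scaled t s≤k refl)
        (strict-bounds (S t) (pow k) (pow (m * k + b)) (pow t ℤ.* f k) (∣i∣<2^⇒-pow<i (S t) small) (∣i∣<2^⇒i<pow (S t) small) lo hi))
      (big t) bounds))
  magnitude-step (magnitude m b t _ (inj₁ exact)) with ℤₚ.<-cmp 0ℤ c
  ... | tri≈ _ refl _ = magnitude (suc m) b (t + s) (inj₂ (s≤s z≤n)) (inj₁ (ev-zip
      (λ k (s≤k , _) eq → trans (sym (scaled t s≤k eq)) (trans (trans
        (cong (ℤ._+ pow k ℤ.* pow (m * k + b)) (ℤₚ.*-zeroʳ (pow (t + s)))) (ℤₚ.+-identityˡ (pow k ℤ.* pow (m * k + b)))) (pow-suc-m m b k)))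
      (big t) exact))
  ... | tri< 0<c _ _ = magnitude (suc m) b (t + s) (inj₂ (s≤s z≤n)) (inj₂ (ev-zip
      (λ k (s≤k , small , _) eq → subst₂ Between (pow-suc-m m b k) (scaled t s≤k eq)
        (positive-correction (S t) (pow k) (pow (m * k + b))
          (subst (ℤ._< pow (t + s) ℤ.* c) (ℤₚ.*-zeroʳ (pow (t + s))) (ℤₚ.*-monoˡ-<-pos (pow (t + s)) 0<c))
          (∣i∣<2^⇒i<pow (S t) small) (1≤pow (m * k + b))))
      (big t) exact))
  ... | tri> _ _ c<0 = magnitude (suc m) b (suc (t + s)) (inj₂ (s≤s z≤n)) (inj₂ (ev-zip
      (λ k (s≤k , _ , small) eq → subst₂ Between (pow-suc-m m b k)
        (trans (cong (ℤ._*_ (+ 2)) (scaled t s≤k eq)) (trans (sym (ℤₚ.*-assoc (+ 2) (pow (t + s)) (g k))) (cong (ℤ._* g k) (sym (pow-suc (t + s))))))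
        (negative-correction (S t) (pow k) (pow (m * k + b))
          (subst (pow (t + s) ℤ.* c ℤ.<_) (ℤₚ.*-zeroʳ (pow (t + s))) (ℤₚ.*-monoˡ-<-pos (pow (t + s)) c<0))
          (∣i∣<2^⇒-pow<i (+ 2 ℤ.* S t) small) (1≤pow (m * k + b))))
      (big t) exact))

  -- One Horner step: `c` decides only if `f` vanishes. Otherwise the term with `f` dominates; in
  -- the negative case `f k ≤ -1`, so that term is at most `- pow (k ∸ s)`.
  sign-step : Sign f → Sign g
  sign-step (vanishing eq) = constant-sign c (ev-map
    (λ k e → trans (cong (λ x → c ℤ.+ pow (k ∸ s) ℤ.* x) e)
      (trans (cong (ℤ._+_ c) (ℤₚ.*-zeroʳ (pow (k ∸ s)))) (ℤₚ.+-identityʳ c))) eq)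
  sign-step (positive μ)   = positive (magnitude-step μ)
  sign-step (negative lt)  = negative (ev-zip below (ev-2^ s ∣ c ∣) lt)
    where
    open ℤₚ.≤-Reasoning
    below : ∀ k → ∣ c ∣ < 2 ^ (k ∸ s) → f k ℤ.< 0ℤ → g k ℤ.< 0ℤ
    below k small f<0 = begin-strict
      c ℤ.+ pow (k ∸ s) ℤ.* f k            <⟨ ℤₚ.+-monoˡ-< (pow (k ∸ s) ℤ.* f k) (∣i∣<2^⇒i<pow c small) ⟩
      pow (k ∸ s) ℤ.+ pow (k ∸ s) ℤ.* f k  ≡⟨ ℤₚ.*-suc (pow (k ∸ s)) (f k) ⟨
      pow (k ∸ s) ℤ.* ℤ.suc (f k)          ≤⟨ ℤₚ.*-monoˡ-≤-nonNeg (pow (k ∸ s)) (ℤₚ.i<j⇒suc[i]≤j f<0) ⟩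
      pow (k ∸ s) ℤ.* 0ℤ                   ≡⟨ ℤₚ.*-zeroʳ (pow (k ∸ s)) ⟩
      0ℤ                                   ∎

-- The fixed number `c - d` is a multiple of `pow (k ∸ s)`, and for large `k` it is smaller than
-- that in absolute value, so it is zero. The power then cancels from what remains.
digit-unique : ∀ s {c d} {f g : ℕ → ℤ} →
  Eventually (λ k → c ℤ.+ pow (k ∸ s) ℤ.* f k ≡ d ℤ.+ pow (k ∸ s) ℤ.* g k) →
  c ≡ d × Eventually (λ k → f k ≡ g k)
digit-unique s {c} {d} {f} {g} ev = c≡d , ev-map (λ k eq →
    ℤₚ.*-cancelˡ-≡ (pow (k ∸ s)) (f k) (g k) {{pow-nonZero {k ∸ s}}}
      (+-cancelˡ c (pow (k ∸ s) ℤ.* f k) (pow (k ∸ s) ℤ.* g k) (trans eq (cong (ℤ._+ pow (k ∸ s) ℤ.* g k) (sym c≡d))))) ev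
  where
  rearrange : ∀ y f g → c ℤ.+ y ℤ.* f ≡ d ℤ.+ y ℤ.* g → c ℤ.- d ≡ y ℤ.* (g ℤ.- f)
  rearrange y f g eq = begin
    c ℤ.- d                                ≡⟨ solve (c ∷ d ∷ y ∷ f ∷ []) ⟩
    (c ℤ.+ y ℤ.* f) ℤ.- (d ℤ.+ y ℤ.* f)    ≡⟨ cong (ℤ._- (d ℤ.+ y ℤ.* f)) eq ⟩
    (d ℤ.+ y ℤ.* g) ℤ.- (d ℤ.+ y ℤ.* f)    ≡⟨ solve (d ∷ y ∷ f ∷ g ∷ []) ⟩
    y ℤ.* (g ℤ.- f)                        ∎
    where open ≡-Reasoning
  small-multiple : ∀ i n e → ∣ i ∣ < 2 ^ n → i ≡ pow n ℤ.* e → i ≡ 0ℤ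
  small-multiple i n e small eq with ∣ e ∣ ℕₚ.≟ 0
  ... | yes ∣e∣≡0 = trans eq (trans (cong (ℤ._*_ (pow n)) (ℤₚ.∣i∣≡0⇒i≡0 ∣e∣≡0)) (ℤₚ.*-zeroʳ (pow n)))
  ... | no ∣e∣≢0 = contradiction (ℕₚ.≤-trans (ℕₚ.m≤m*n (2 ^ n) ∣ e ∣ {{ℕ.≢-nonZero ∣e∣≢0}})
                  (ℕₚ.≤-reflexive (sym (trans (cong ∣_∣ eq) (trans (cong (λ p → ∣ p ℤ.* e ∣) (pow≡ n)) (ℤₚ.abs-* (+ (2 ^ n)) e))))))
                  (ℕₚ.<⇒≱ small)
  c≡d : c ≡ d
  c≡d with ev-witness (ev-and ev (ev-2^ s ∣ c ℤ.- d ∣))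
  ... | k , eq , small = ℤₚ.i-j≡0⇒i≡j c d
    (small-multiple (c ℤ.- d) (k ∸ s) (g k ℤ.- f k) small (rearrange (pow (k ∸ s)) (f k) (g k) eq))

-- Polynomials in X and their normal forms

Polynomial : Set
Polynomial = List ℤ

horner : Polynomial → ℤ → ℤ
horner []      x = 0ℤ
horner (c ∷ r) x = c ℤ.+ x ℤ.* horner r x

_+ᴾ_ : Polynomial → Polynomial → Polynomial
[]      +ᴾ s       = s
(c ∷ r) +ᴾ []      = c ∷ r
(c ∷ r) +ᴾ (d ∷ s) = (c ℤ.+ d) ∷ (r +ᴾ s)

scale : ℤ → Polynomial → Polynomial
scale a = map (a ℤ.*_)

_*ᴾ_ : Polynomial → Polynomial → Polynomial
[]      *ᴾ s = []
(c ∷ r) *ᴾ s = scale c s +ᴾ (0ℤ ∷ (r *ᴾ s))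

horner-+ : ∀ r s x → horner (r +ᴾ s) x ≡ horner r x ℤ.+ horner s x
horner-+ []      s       x = sym (ℤₚ.+-identityˡ (horner s x))
horner-+ (c ∷ r) []      x = sym (ℤₚ.+-identityʳ (horner (c ∷ r) x))
horner-+ (c ∷ r) (d ∷ s) x = identity (horner r x) (horner s x) (horner-+ r s x)
  where
  identity : ∀ p q {pq} → pq ≡ p ℤ.+ q → c ℤ.+ d ℤ.+ x ℤ.* pq ≡ c ℤ.+ x ℤ.* p ℤ.+ (d ℤ.+ x ℤ.* q)
  identity p q refl = solve (c ∷ d ∷ x ∷ p ∷ q ∷ [])

horner-scale : ∀ a r x → horner (scale a r) x ≡ a ℤ.* horner r x
horner-scale a []      x = sym (ℤₚ.*-zeroʳ a)
horner-scale a (c ∷ r) x = identity (horner r x) (horner-scale a r x)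
  where
  identity : ∀ p {ap} → ap ≡ a ℤ.* p → a ℤ.* c ℤ.+ x ℤ.* ap ≡ a ℤ.* (c ℤ.+ x ℤ.* p)
  identity p refl = solve (a ∷ c ∷ x ∷ p ∷ [])

horner-* : ∀ r s x → horner (r *ᴾ s) x ≡ horner r x ℤ.* horner s x
horner-* []      s x = sym (ℤₚ.*-zeroˡ (horner s x))
horner-* (c ∷ r) s x = trans (horner-+ (scale c s) (0ℤ ∷ (r *ᴾ s)) x)
    (identity (horner r x) (horner s x) (horner-scale c s x) (horner-* r s x))
  where
  identity : ∀ p q {cq pq} → cq ≡ c ℤ.* q → pq ≡ p ℤ.* q →
    cq ℤ.+ (0ℤ ℤ.+ x ℤ.* pq) ≡ (c ℤ.+ x ℤ.* p) ℤ.* q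
  identity p q refl refl = solve (c ∷ x ∷ p ∷ q ∷ [])

horner-sign : ∀ r → Sign (λ k → horner r (pow k))
horner-sign []      = vanishing (always (λ _ → refl))
horner-sign (c ∷ r) = sign-step 0 c (horner-sign r)

-- raw c t r stands for c + (X / 2ᵗ) r(X), and ⟪ raw c t r ⟫ k is its value at X = 2ᵏ for k ≥ t.
record Raw : Set where
  constructor raw
  field
    constant : ℤ
    shift    : ℕ
    rest     : Polynomial

⟪_⟫ : Raw → ℕ → ℤ
⟪ raw c t r ⟫ k = c ℤ.+ pow (k ∸ t) ℤ.* horner r (pow k)

raw-sign : ∀ p → Sign ⟪ p ⟫
raw-sign (raw c t r) = sign-step t c (horner-sign r)

pow-unshift : ∀ t u {k} → t + u ≤ k → pow (k ∸ t) ≡ pow u ℤ.* pow (k ∸ (t + u))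
pow-unshift t u {k} le = trans (pow-split (ℕₚ.m+n≤o⇒m≤o∸n u (subst (_≤ k) (ℕₚ.+-comm t u) le)))
  (cong (λ n → pow u ℤ.* pow n) (ℕₚ.∸-+-assoc k t u))

pow-unshift′ : ∀ t u {k} → t + u ≤ k → pow (k ∸ u) ≡ pow t ℤ.* pow (k ∸ (t + u))
pow-unshift′ t u {k} le = trans (pow-unshift u t (subst (_≤ k) (ℕₚ.+-comm t u) le))
  (cong (λ n → pow t ℤ.* pow (k ∸ n)) (ℕₚ.+-comm u t))

constantᴿ : ℤ → Raw
constantᴿ c = raw c 0 []

⟪constantᴿ⟫ : ∀ c k → ⟪ constantᴿ c ⟫ k ≡ c
⟪constantᴿ⟫ c k = trans (cong (ℤ._+_ c) (ℤₚ.*-zeroʳ (pow k))) (ℤₚ.+-identityʳ c)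

Xᴿ : Raw
Xᴿ = raw 0ℤ 0 (1ℤ ∷ [])

⟪Xᴿ⟫ : ∀ k → ⟪ Xᴿ ⟫ k ≡ pow k
⟪Xᴿ⟫ k = identity (pow k)
  where
  identity : ∀ x → 0ℤ ℤ.+ x ℤ.* (1ℤ ℤ.+ x ℤ.* 0ℤ) ≡ x
  identity x = solve (x ∷ [])

-- The rests are brought to the common denominator `2 ^ (t + u)`, without reduction; cancelling is
-- left to `norm`.
_+ᴿ_ : Raw → Raw → Raw
raw c t r +ᴿ raw d u s = raw (c ℤ.+ d) (t + u) (scale (pow u) r +ᴾ scale (pow t) s)

⟪+ᴿ⟫ : ∀ p q → Eventually (λ k → ⟪ p +ᴿ q ⟫ k ≡ ⟪ p ⟫ k ℤ.+ ⟪ q ⟫ k)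
⟪+ᴿ⟫ (raw c t r) (raw d u s) = ev-map
  (λ k le → identity (pow t) (pow u) (pow (k ∸ (t + u))) (horner r (pow k)) (horner s (pow k))
    (pow-unshift t u le) (pow-unshift′ t u le)
    (trans (horner-+ (scale (pow u) r) (scale (pow t) s) (pow k))
      (cong₂ ℤ._+_ (horner-scale (pow u) r (pow k)) (horner-scale (pow t) s (pow k)))))
  (ev-≥ (t + u))
  where
  identity : ∀ t u z r s {y₁ y₂ q} → y₁ ≡ u ℤ.* z → y₂ ≡ t ℤ.* z → q ≡ u ℤ.* r ℤ.+ t ℤ.* s →
    (c ℤ.+ d) ℤ.+ z ℤ.* q ≡ (c ℤ.+ y₁ ℤ.* r) ℤ.+ (d ℤ.+ y₂ ℤ.* s)
  identity t u z r s refl refl refl = solve (c ∷ d ∷ t ∷ u ∷ z ∷ r ∷ s ∷ [])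

-ᴿ_ : Raw → Raw
-ᴿ raw c t r = raw (ℤ.- c) t (scale (ℤ.- 1ℤ) r)

⟪-ᴿ⟫ : ∀ p k → ⟪ -ᴿ p ⟫ k ≡ ℤ.- ⟪ p ⟫ k
⟪-ᴿ⟫ (raw c t r) k = identity (pow (k ∸ t)) (horner r (pow k)) (horner-scale (ℤ.- 1ℤ) r (pow k))
  where
  identity : ∀ y p {q} → q ≡ (ℤ.- 1ℤ) ℤ.* p → ℤ.- c ℤ.+ y ℤ.* q ≡ ℤ.- (c ℤ.+ y ℤ.* p)
  identity y p refl = solve (c ∷ y ∷ p ∷ [])

-- The product of the two nonconstant parts is X / 2ᵗ⁺ᵘ times X r s, which explains the entry `0ℤ`.
-- Each mixed term is multiplied by the power of two missing from its denominator.
_*ᴿ_ : Raw → Raw → Raw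
raw c t r *ᴿ raw d u s = raw (c ℤ.* d) (t + u)
  (scale (pow t ℤ.* c) s +ᴾ (scale (pow u ℤ.* d) r +ᴾ (0ℤ ∷ (r *ᴾ s))))

⟪*ᴿ⟫ : ∀ p q → Eventually (λ k → ⟪ p *ᴿ q ⟫ k ≡ ⟪ p ⟫ k ℤ.* ⟪ q ⟫ k)
⟪*ᴿ⟫ (raw c t r) (raw d u s) = ev-map
  (λ k le → identity (pow t) (pow u) (pow (k ∸ (t + u))) (horner r (pow k)) (horner s (pow k))
    (trans (pow-split le) (cong (ℤ._* pow (k ∸ (t + u))) (pow-+ t u)))
    (pow-unshift t u le) (pow-unshift′ t u le)
    (trans (horner-+ (scale (pow t ℤ.* c) s) _ (pow k)) (cong₂ ℤ._+_ (horner-scale (pow t ℤ.* c) s (pow k))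
      (trans (horner-+ (scale (pow u ℤ.* d) r) (0ℤ ∷ (r *ᴾ s)) (pow k)) (cong₂ ℤ._+_ (horner-scale (pow u ℤ.* d) r (pow k))
        (cong (λ p → 0ℤ ℤ.+ pow k ℤ.* p) (horner-* r s (pow k))))))))
  (ev-≥ (t + u))
  where
  identity : ∀ t u z r s {x y₁ y₂ q} → x ≡ t ℤ.* u ℤ.* z → y₁ ≡ u ℤ.* z → y₂ ≡ t ℤ.* z →
    q ≡ t ℤ.* c ℤ.* s ℤ.+ (u ℤ.* d ℤ.* r ℤ.+ (0ℤ ℤ.+ x ℤ.* (r ℤ.* s))) →
    c ℤ.* d ℤ.+ z ℤ.* q ≡ (c ℤ.+ y₁ ℤ.* r) ℤ.* (d ℤ.+ y₂ ℤ.* s)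
  identity t u z r s refl refl refl refl = solve (c ∷ d ∷ t ∷ u ∷ z ∷ r ∷ s ∷ [])

-- A cons that does not put zero on the empty list, so that `trim` drops the zero coefficients at
-- the high end.
_◂_ : ℤ → Polynomial → Polynomial
c ◂ (d ∷ r) = c ∷ d ∷ r
c ◂ [] with c ℤ.≟ 0ℤ
... | yes _ = []
... | no  _ = c ∷ []

trim : Polynomial → Polynomial
trim []      = []
trim (c ∷ r) = c ◂ trim r

horner-◂ : ∀ c r x → horner (c ◂ r) x ≡ c ℤ.+ x ℤ.* horner r x
horner-◂ c (d ∷ r) x = refl
horner-◂ c [] x with c ℤ.≟ 0ℤ
... | yes refl = sym (trans (ℤₚ.+-identityˡ (x ℤ.* 0ℤ)) (ℤₚ.*-zeroʳ x))
... | no _     = refl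

horner-trim : ∀ r x → horner (trim r) x ≡ horner r x
horner-trim []      x = refl
horner-trim (c ∷ r) x = trans (horner-◂ c (trim r) x) (cong (λ p → c ℤ.+ x ℤ.* p) (horner-trim r x))

◂-scale : ∀ a .{{_ : ℤ.NonZero a}} c r → (a ℤ.* c) ◂ scale a r ≡ scale a (c ◂ r)
◂-scale a c (d ∷ r) = refl
◂-scale a c [] with a ℤ.* c ℤ.≟ 0ℤ | c ℤ.≟ 0ℤ
... | yes _    | yes _   = refl
... | no _     | no _    = refl
... | yes ac≡0 | no c≢0  = contradiction (ℤₚ.*-cancelˡ-≡ a c 0ℤ (trans ac≡0 (sym (ℤₚ.*-zeroʳ a)))) c≢0
... | no ac≢0  | yes c≡0 = contradiction (trans (cong (ℤ._*_ a) c≡0) (ℤₚ.*-zeroʳ a)) ac≢0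

trim-scale : ∀ a .{{_ : ℤ.NonZero a}} r → trim (scale a r) ≡ scale a (trim r)
trim-scale a []      = refl
trim-scale a (c ∷ r) = trans (cong ((a ℤ.* c) ◂_) (trim-scale a r)) (◂-scale a c (trim r))

private
  as-zero : ∀ x → 0ℤ ≡ 0ℤ ℤ.+ x ℤ.* 0ℤ
  as-zero x = sym (trans (ℤₚ.+-identityˡ (x ℤ.* 0ℤ)) (ℤₚ.*-zeroʳ x))

-- Coefficients are compared from the constant one upwards by `digit-unique` with shift 0. An
-- exhausted list counts as one more zero coefficient followed by the empty list.
trim-unique : ∀ r s → Eventually (λ k → horner r (pow k) ≡ horner s (pow k)) → trim r ≡ trim s
trim-unique []      []      eq = refl
trim-unique []      (d ∷ s) eq
  with digit-unique 0 {0ℤ} {d} {λ _ → 0ℤ} {λ k → horner s (pow k)} (ev-map (λ k e → trans (sym (as-zero (pow k))) e) eq)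
... | refl , eq′ = cong (0ℤ ◂_) (trim-unique [] s eq′)
trim-unique (c ∷ r) []      eq
  with digit-unique 0 {c} {0ℤ} {λ k → horner r (pow k)} {λ _ → 0ℤ} (ev-map (λ k e → trans e (as-zero (pow k))) eq)
... | refl , eq′ = cong (0ℤ ◂_) (trim-unique r [] eq′)
trim-unique (c ∷ r) (d ∷ s) eq
  with digit-unique 0 {c} {d} {λ k → horner r (pow k)} {λ k → horner s (pow k)} eq
... | refl , eq′ = cong (c ◂_) (trim-unique r s eq′)

even? : ∀ c → Dec (∃[ d ] + 2 ℤ.* d ≡ c)
even? c = map′ (λ (divides d eq) → d , trans (ℤₚ.*-comm (+ 2) d) (sym eq))
               (λ (d , eq) → divides d (trans (sym eq) (ℤₚ.*-comm (+ 2) d)))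
               (+ 2 ∣ℤ? c)

halve? : ∀ r → Dec (∃[ s ] scale (+ 2) s ≡ r)
halve? []      = yes ([] , refl)
halve? (c ∷ r) = map′ (λ ((d , p) , (s , q)) → d ∷ s , cong₂ _∷_ p q)
                      (λ { (d ∷ s , refl) → (d , refl) , (s , refl) })
                      (even? c ×-dec halve? r)

-- Cancels twos between the denominator of X / 2ᵗ and the coefficients of `r`, until the shift is
-- zero or some coefficient is odd. The empty rest can always be halved, so it ends with shift zero.
reduce : ℤ → ℕ → Polynomial → Raw
reduce c zero    r = raw c 0 r
reduce c (suc t) r with halve? r
... | yes (s , _) = reduce c t s
... | no  _       = raw c (suc t) r

reduce-double : ∀ c t r → reduce c (suc t) (scale (+ 2) r) ≡ reduce c t r
reduce-double c t r with halve? (scale (+ 2) r)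
... | yes (s , eq) = cong (reduce c t) (map-injective (λ {x} {y} → ℤₚ.*-cancelˡ-≡ (+ 2) x y) eq)
... | no ∄         = contradiction (r , refl) ∄

reduce-scale : ∀ n c t r → reduce c (n + t) (scale (pow n) r) ≡ reduce c t r
reduce-scale zero c t r = cong (reduce c t) (trans (map-cong (λ x → trans (cong (ℤ._* x) (pow≡ 0)) (ℤₚ.*-identityˡ x)) r) (map-id r))
reduce-scale (suc n) c t r = begin
  reduce c (suc n + t) (scale (pow (suc n)) r)          ≡⟨ cong (reduce c (suc n + t)) (map-cong (λ x →
                                                             trans (cong (ℤ._* x) (pow-suc n)) (ℤₚ.*-assoc (+ 2) (pow n) x)) r) ⟩
  reduce c (suc n + t) (map (λ x → + 2 ℤ.* (pow n ℤ.* x)) r) ≡⟨ cong (reduce c (suc n + t)) (map-∘ r) ⟩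
  reduce c (suc n + t) (scale (+ 2) (scale (pow n) r))  ≡⟨ reduce-double c (n + t) (scale (pow n) r) ⟩
  reduce c (n + t) (scale (pow n) r)                    ≡⟨ reduce-scale n c t r ⟩
  reduce c t r                                          ∎
  where open ≡-Reasoning

⟪reduce⟫ : ∀ c t r → Eventually (λ k → ⟪ reduce c t r ⟫ k ≡ ⟪ raw c t r ⟫ k)
⟪reduce⟫ c zero    r = always (λ _ → refl)
⟪reduce⟫ c (suc t) r with halve? r
... | no _           = always (λ _ → refl)
... | yes (s , refl) = ev-zip (λ k ih le → trans ih
    (identity (pow (k ∸ suc t)) (horner s (pow k))
      (trans (pow-unshift t 1 (subst (_≤ k) (ℕₚ.+-comm 1 t) le)) (cong₂ ℤ._*_ (pow≡ 1) (cong (λ n → pow (k ∸ n)) (ℕₚ.+-comm t 1))))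
      (horner-scale (+ 2) s (pow k))))
    (⟪reduce⟫ c t s) (ev-≥ (suc t))
  where
  identity : ∀ z p {y q} → y ≡ + 2 ℤ.* z → q ≡ + 2 ℤ.* p → c ℤ.+ y ℤ.* p ≡ c ℤ.+ z ℤ.* q
  identity z p refl refl = solve (c ∷ z ∷ p ∷ [])

norm : Raw → Raw
norm (raw c t r) = reduce c t (trim r)

⟪norm⟫ : ∀ p → Eventually (λ k → ⟪ norm p ⟫ k ≡ ⟪ p ⟫ k)
⟪norm⟫ (raw c t r) = ev-map
  (λ k e → trans e (cong (λ p → c ℤ.+ pow (k ∸ t) ℤ.* p) (horner-trim r (pow k))))
  (⟪reduce⟫ c t (trim r))

shift-out : ∀ c a z r x {y} → y ≡ a ℤ.* z → c ℤ.+ y ℤ.* horner r x ≡ c ℤ.+ z ℤ.* horner (scale a r) x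
shift-out c a z r x refl = cong (ℤ._+_ c) (trans (identity z (horner r x)) (cong (ℤ._*_ z) (sym (horner-scale a r x))))
  where
  identity : ∀ z p → a ℤ.* z ℤ.* p ≡ z ℤ.* (a ℤ.* p)
  identity z p = solve (a ∷ z ∷ p ∷ [])

-- Over the common shift `t + u`, `digit-unique` identifies the constants and `trim-unique` the
-- scaled rests. By `reduce-scale`, scaling and raising the shift together do not change the reduced
-- form.
norm-unique : ∀ p q → Eventually (λ k → ⟪ p ⟫ k ≡ ⟪ q ⟫ k) → norm p ≡ norm q
norm-unique (raw c t r) (raw d u s) eq with digit-unique (t + u)
  {c} {d} {λ k → horner (scale (pow u) r) (pow k)} {λ k → horner (scale (pow t) s) (pow k)}
  (ev-zip (λ k le e → trans (sym (shift-out c (pow u) (pow (k ∸ (t + u))) r (pow k) (pow-unshift t u le)))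
    (trans e (shift-out d (pow t) (pow (k ∸ (t + u))) s (pow k) (pow-unshift′ t u le)))) (ev-≥ (t + u)) eq)
... | refl , eq′ = begin
  reduce c t (trim r)                             ≡⟨ reduce-scale u c t (trim r) ⟨
  reduce c (u + t) (scale (pow u) (trim r))       ≡⟨ cong₂ (reduce c) (ℕₚ.+-comm u t) same ⟩
  reduce c (t + u) (scale (pow t) (trim s))       ≡⟨ reduce-scale t c u (trim s) ⟩
  reduce c u (trim s)                             ∎
  where
  open ≡-Reasoning
  same : scale (pow u) (trim r) ≡ scale (pow t) (trim s)
  same = trans (sym (trim-scale (pow u) {{pow-nonZero {u}}} r))
    (trans (trim-unique (scale (pow u) r) (scale (pow t) s) eq′) (trim-scale (pow t) {{pow-nonZero {t}}} s))

-- Halving and odd parts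

1+2i≢2j : ∀ {e f} → 1ℤ ℤ.+ + 2 ℤ.* e ≢ + 2 ℤ.* f
1+2i≢2j {e} {f} eq with ∣ f ℤ.- e ∣ | trans (cong ∣_∣ 1≡) (ℤₚ.abs-* (+ 2) (f ℤ.- e))
  where
  1≡ : 1ℤ ≡ + 2 ℤ.* (f ℤ.- e)
  1≡ = begin
    1ℤ                                      ≡⟨ solve (e ∷ []) ⟩
    (1ℤ ℤ.+ + 2 ℤ.* e) ℤ.- + 2 ℤ.* e        ≡⟨ cong (ℤ._- + 2 ℤ.* e) eq ⟩
    + 2 ℤ.* f ℤ.- + 2 ℤ.* e                 ≡⟨ solve (e ∷ f ∷ []) ⟩
    + 2 ℤ.* (f ℤ.- e)                       ∎
    where open ≡-Reasoning
... | zero  | ()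
... | suc n | 1≡2n with trans 1≡2n (ℕₚ.*-suc 2 n)
...   | ()

odd-part : ∀ c → c ≢ 0ℤ → ∃[ j ] ∃[ e ] c ≡ pow j ℤ.* (1ℤ ℤ.+ + 2 ℤ.* e)
odd-part c = bounded ∣ c ∣ c ℕₚ.≤-refl
  where
  bounded : ∀ n c → ∣ c ∣ ≤ n → c ≢ 0ℤ → ∃[ j ] ∃[ e ] c ≡ pow j ℤ.* (1ℤ ℤ.+ + 2 ℤ.* e)
  bounded zero    c le c≢0 = contradiction (ℤₚ.∣i∣≡0⇒i≡0 (ℕₚ.n≤0⇒n≡0 le)) c≢0
  bounded (suc n) c le c≢0 with c ℤD.%ℕ 2 | c ℤD./ℕ 2 | ℤD.a≡a%ℕn+[a/ℕn]*n c 2 | ℤD.n%ℕd<d c 2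
  ... | 0 | q | eq | _ = suc j , e , trans c≡2q (trans (cong (ℤ._*_ (+ 2)) q≡) (trans
          (sym (ℤₚ.*-assoc (+ 2) (pow j) (1ℤ ℤ.+ + 2 ℤ.* e))) (cong (ℤ._* (1ℤ ℤ.+ + 2 ℤ.* e)) (sym (pow-suc j)))))
    where
    c≡2q : c ≡ + 2 ℤ.* q
    c≡2q = trans eq (trans (ℤₚ.+-identityˡ (q ℤ.* + 2)) (ℤₚ.*-comm q (+ 2)))
    q≢0 : q ≢ 0ℤ
    q≢0 q≡0 = c≢0 (trans c≡2q (cong (ℤ._*_ (+ 2)) q≡0))
    ∣q∣<∣c∣ : ∣ q ∣ < ∣ c ∣
    ∣q∣<∣c∣ = subst (∣ q ∣ <_) (sym (trans (cong ∣_∣ c≡2q) (ℤₚ.abs-* (+ 2) q)))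
      (subst (∣ q ∣ <_) (ℕₚ.*-comm ∣ q ∣ 2) (ℕₚ.m<m*n ∣ q ∣ 2 {{ℕ.≢-nonZero (q≢0 ∘ ℤₚ.∣i∣≡0⇒i≡0)}} (s≤s (s≤s z≤n))))
    ih = bounded n q (ℕₚ.≤-pred (ℕₚ.≤-trans ∣q∣<∣c∣ le)) q≢0
    j = proj₁ ih
    e = proj₁ (proj₂ ih)
    q≡ = proj₂ (proj₂ ih)
  ... | 1 | q | eq | _ = 0 , q , trans eq (trans (cong (ℤ._+_ 1ℤ) (ℤₚ.*-comm q (+ 2)))
          (sym (trans (cong (ℤ._* (1ℤ ℤ.+ + 2 ℤ.* q)) (pow≡ 0)) (ℤₚ.*-identityˡ (1ℤ ℤ.+ + 2 ℤ.* q)))))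
  ... | suc (suc _) | _ | _ | s≤s (s≤s ())

-- Once `k` exceeds `t`, the nonconstant part is even, so the constant is even too. Halving the
-- constant and raising the shift by one halves the whole expression.
halved : ∀ p (g : ℕ → ℤ) → Eventually (λ k → ⟪ p ⟫ k ≡ + 2 ℤ.* g k) → ∃[ q ] Eventually (λ k → ⟪ q ⟫ k ≡ g k)
halved (raw c t r) g eq = raw d (suc t) r , ev-zip
    (λ k e le → ℤₚ.*-cancelˡ-≡ (+ 2) (⟪ raw d (suc t) r ⟫ k) (g k)
      (trans (sym (double (pow (k ∸ suc t)) (horner r (pow k)) c≡2d (unshift le))) e))
    eq (ev-≥ (suc t))
  where
  unshift : ∀ {k} → suc t ≤ k → pow (k ∸ t) ≡ + 2 ℤ.* pow (k ∸ suc t)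
  unshift {k} le = trans (pow-unshift′ 1 t le) (cong (ℤ._* pow (k ∸ suc t)) (pow≡ 1))
  k₀ = proj₁ (ev-witness (ev-and eq (ev-≥ (suc t))))
  d : ℤ
  -- Half of `c`, read off from the equation at the single argument `k₀`.
  d = g k₀ ℤ.- pow (k₀ ∸ suc t) ℤ.* horner r (pow k₀)
  double : ∀ z p {d y} → c ≡ + 2 ℤ.* d → y ≡ + 2 ℤ.* z → c ℤ.+ y ℤ.* p ≡ + 2 ℤ.* (d ℤ.+ z ℤ.* p)
  double z p {d} refl refl = solve (d ∷ z ∷ p ∷ [])
  solve-c : ∀ z p g {y} → y ≡ + 2 ℤ.* z → c ℤ.+ y ℤ.* p ≡ + 2 ℤ.* g → c ≡ + 2 ℤ.* (g ℤ.- z ℤ.* p)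
  solve-c z p g refl e = begin
    c                                                   ≡⟨ solve (c ∷ z ∷ p ∷ []) ⟩
    (c ℤ.+ + 2 ℤ.* z ℤ.* p) ℤ.- + 2 ℤ.* z ℤ.* p         ≡⟨ cong (ℤ._- + 2 ℤ.* z ℤ.* p) e ⟩
    + 2 ℤ.* g ℤ.- + 2 ℤ.* z ℤ.* p                       ≡⟨ solve (g ∷ z ∷ p ∷ []) ⟩
    + 2 ℤ.* (g ℤ.- z ℤ.* p)                             ∎
    where open ≡-Reasoning
  c≡2d : c ≡ + 2 ℤ.* d
  c≡2d = let (_ , e , le) = ev-witness (ev-and eq (ev-≥ (suc t)))
         in solve-c (pow (k₀ ∸ suc t)) (horner r (pow k₀)) (g k₀) (unshift le) e

-- The constant alone fixes the parity of the values at large `k`, since the other part is even as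
-- soon as `k` exceeds the shift.
Odd : Raw → Set
Odd p = ∃[ e ] Raw.constant p ≡ 1ℤ ℤ.+ + 2 ℤ.* e

odd-not-even : ∀ {p} (g : ℕ → ℤ) → Odd p → ¬ Eventually (λ k → ⟪ p ⟫ k ≡ + 2 ℤ.* g k)
odd-not-even {p} g (e , eq) ev with ev-witness (ev-and ev (ev-≥ (suc (Raw.shift p))))
... | k , even , le = 1+2i≢2j {e ℤ.+ pow (k ∸ suc (Raw.shift p)) ℤ.* horner (Raw.rest p) (pow k)} {g k}
    (trans (sym (split (pow (k ∸ suc (Raw.shift p))) (horner (Raw.rest p) (pow k)) eq
       (trans (pow-unshift′ 1 (Raw.shift p) le) (cong (ℤ._* pow (k ∸ suc (Raw.shift p))) (pow≡ 1))))) even)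
  where
  split : ∀ z p {c y} → c ≡ 1ℤ ℤ.+ + 2 ℤ.* e → y ≡ + 2 ℤ.* z → c ℤ.+ y ℤ.* p ≡ 1ℤ ℤ.+ + 2 ℤ.* (e ℤ.+ z ℤ.* p)
  split z p refl refl = solve (e ∷ z ∷ p ∷ [])

-- With denominators cleared, this says that `p` is 2ᵇ⁻ᵗ Xᵐ times an odd `q`.
record Factorization (p : Raw) : Set where
  constructor factorization
  field
    m b t : ℕ
    shape : t ≡ 0 ⊎ 1 ≤ m
    q     : Raw
    q-odd : Odd q
    eq    : Eventually (λ k → pow t ℤ.* ⟪ p ⟫ k ≡ pow (m * k + b) ℤ.* ⟪ q ⟫ k)

-- The power of two in `c` is also taken out of the nonconstant part, by raising its shift by the
-- same exponent `j`.
factor-constant : ∀ c t r → c ≢ 0ℤ → ∃[ j ] ∃[ q ] Odd q × Eventually (λ k → ⟪ raw c t r ⟫ k ≡ pow j ℤ.* ⟪ q ⟫ k)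
factor-constant c t r c≢0 with odd-part c c≢0
... | j , e , c≡ = j , raw (1ℤ ℤ.+ + 2 ℤ.* e) (t + j) r , (e , refl) ,
  ev-map (λ k le → identity (pow j) (pow (k ∸ (t + j))) (horner r (pow k)) (1ℤ ℤ.+ + 2 ℤ.* e) c≡ (pow-unshift t j le))
    (ev-≥ (t + j))
  where
  identity : ∀ j z p d {y} → c ≡ j ℤ.* d → y ≡ j ℤ.* z → c ℤ.+ y ℤ.* p ≡ j ℤ.* (d ℤ.+ z ℤ.* p)
  identity j z p d refl refl = solve (j ∷ z ∷ p ∷ d ∷ [])

lowest-term : ∀ r → (∀ x → horner r x ≡ 0ℤ) ⊎
  (∃[ m ] ∃[ c ] ∃[ s ] c ≢ 0ℤ × (∀ k → horner r (pow k) ≡ pow (m * k) ℤ.* (c ℤ.+ pow k ℤ.* horner s (pow k))))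
lowest-term [] = inj₁ (λ _ → refl)
lowest-term (c ∷ r) with c ℤ.≟ 0ℤ
... | no c≢0 = inj₂ (0 , c , r , c≢0 , λ k →
      sym (trans (cong (ℤ._* (c ℤ.+ pow k ℤ.* horner r (pow k))) (pow≡ 0)) (ℤₚ.*-identityˡ (c ℤ.+ pow k ℤ.* horner r (pow k)))))
... | yes refl with lowest-term r
...   | inj₁ r≡0 = inj₁ (λ x → trans (cong (λ p → 0ℤ ℤ.+ x ℤ.* p) (r≡0 x)) (trans (ℤₚ.+-identityˡ (x ℤ.* 0ℤ)) (ℤₚ.*-zeroʳ x)))
...   | inj₂ (m , d , s , d≢0 , eq) = inj₂ (suc m , d , s , d≢0 , λ k →
        identity (pow k) (pow (m * k)) (d ℤ.+ pow k ℤ.* horner s (pow k)) (eq k) (pow-+ k (m * k)))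
  where
  identity : ∀ x y z {p xy} → p ≡ y ℤ.* z → xy ≡ x ℤ.* y → 0ℤ ℤ.+ x ℤ.* p ≡ xy ℤ.* z
  identity x y z refl refl = solve (x ∷ y ∷ z ∷ [])

-- A nonzero constant already determines the power of two, with `m = 0`. Otherwise the lowest
-- nonzero coefficient of the rest takes its role, and the prefactor X / 2ᵗ contributes one X and
-- the denominator.
factorize : ∀ p → Eventually (λ k → ⟪ p ⟫ k ≡ 0ℤ) ⊎ Factorization p
factorize (raw c t r) with c ℤ.≟ 0ℤ
... | no c≢0 with factor-constant c t r c≢0
...   | j , q , odd , eq = inj₂ (factorization 0 j 0 (inj₁ refl) q odd (ev-map
        (λ k e → trans (cong (ℤ._* ⟪ raw c t r ⟫ k) (pow≡ 0)) (trans (ℤₚ.*-identityˡ (⟪ raw c t r ⟫ k)) e)) eq))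
factorize (raw c t r) | yes refl with lowest-term r
... | inj₁ r≡0 = inj₁ (always (λ k → trans (cong (λ p → 0ℤ ℤ.+ pow (k ∸ t) ℤ.* p) (r≡0 (pow k)))
        (trans (ℤₚ.+-identityˡ (pow (k ∸ t) ℤ.* 0ℤ)) (ℤₚ.*-zeroʳ (pow (k ∸ t))))))
... | inj₂ (m , d , s , d≢0 , eq) with factor-constant d 0 s d≢0
...   | j , q , odd , eq′ = inj₂ (factorization (suc m) j t (inj₂ (s≤s z≤n)) q odd (ev-zip
        (λ k le e → identity (pow t) (pow (k ∸ t)) (pow (m * k)) (pow j) (⟪ q ⟫ k)
          (trans (eq k) (cong (ℤ._*_ (pow (m * k))) e)) (begin
            pow (suc m * k + j)                               ≡⟨ pow-+ (k + m * k) j ⟩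
            pow (k + m * k) ℤ.* pow j                         ≡⟨ cong (ℤ._* pow j) (pow-+ k (m * k)) ⟩
            pow k ℤ.* pow (m * k) ℤ.* pow j                   ≡⟨ cong (λ x → x ℤ.* pow (m * k) ℤ.* pow j) (pow-split le) ⟩
            pow t ℤ.* pow (k ∸ t) ℤ.* pow (m * k) ℤ.* pow j   ∎))
        (ev-≥ t) eq′))
  where
  open ≡-Reasoning
  identity : ∀ t y a j q {p w} → p ≡ a ℤ.* (j ℤ.* q) → w ≡ t ℤ.* y ℤ.* a ℤ.* j →
    t ℤ.* (0ℤ ℤ.+ y ℤ.* p) ≡ w ℤ.* q
  identity t y a j q refl refl = solve (t ∷ y ∷ a ∷ j ∷ q ∷ [])

-- The carrier of the model

-- Boolean, so that the field `nonNegative` of `Germ` is an equation, whose proofs coincide by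
-- `uip`. Proofs with differing thresholds would separate germs that should be equal.
isNonNegative : Raw → Bool
isNonNegative p with raw-sign p
... | vanishing _ = true
... | negative _  = false
... | positive _  = true

isNonNegative-sound : ∀ p → isNonNegative p ≡ true → Eventually (λ k → 0ℤ ℤ.≤ ⟪ p ⟫ k)
isNonNegative-sound p eq with raw-sign p
... | vanishing p≡0 = ev-map (λ _ e → ℤₚ.≤-reflexive (sym e)) p≡0
... | positive μ    = ev-map (λ _ → ℤₚ.<⇒≤) (magnitude-positive μ)

isNonNegative-complete : ∀ p → Eventually (λ k → 0ℤ ℤ.≤ ⟪ p ⟫ k) → isNonNegative p ≡ true
isNonNegative-complete p p≥0 with raw-sign p
... | vanishing _  = refl
... | positive _   = refl
... | negative p<0 = ⊥-elim (ev-absurd (λ _ ge lt → ℤₚ.<⇒≱ lt ge) p≥0 p<0)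

-- The normal forms make propositional equality of the carrier coincide with eventual equality of values.
record Germ : Set where
  constructor germ
  field
    code        : Raw
    normal      : norm code ≡ code
    nonNegative : isNonNegative code ≡ true

open Germ using (code)

opaque
  -- A code may take negative values before its threshold; the absolute value gives natural numbers
  -- everywhere and changes nothing for large `k`.
  ⟦_⟧ : Germ → ℕ → ℕ
  ⟦ a ⟧ k = ∣ ⟪ code a ⟫ k ∣

infix 4 _≈_
_≈_ : (f g : ℕ → ℕ) → Set
f ≈ g = Eventually (λ k → f k ≡ g k)

≈-trans : ∀ {f g h} → f ≈ g → g ≈ h → f ≈ h
≈-trans = ev-zip (λ _ → trans)

≈-sym : ∀ {f g} → f ≈ g → g ≈ f
≈-sym = ev-map (λ _ → sym)

opaque
  unfolding ⟦_⟧
  code-nonNegative : ∀ a → Eventually (λ k → ⟪ code a ⟫ k ≡ + ⟦ a ⟧ k)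
  code-nonNegative a = ev-map (λ _ le → sym (ℤₚ.0≤i⇒+∣i∣≡i le)) (isNonNegative-sound (code a) (Germ.nonNegative a))

code-injective : ∀ a b → code a ≡ code b → a ≡ b
code-injective (germ p n₁ b₁) (germ .p n₂ b₂) refl = cong₂ (germ p) (uip n₁ n₂) (uip b₁ b₂)

opaque
  unfolding ⟦_⟧
  ≈⇒≡ : ∀ a b → ⟦ a ⟧ ≈ ⟦ b ⟧ → a ≡ b
  ≈⇒≡ a b eq = code-injective a b (trans (sym (Germ.normal a)) (trans
    (norm-unique (code a) (code b) (ev-zip (λ _ e (p , q) → trans p (trans (cong +_ e) (sym q)))
      eq (ev-and (code-nonNegative a) (code-nonNegative b))))
    (Germ.normal b)))

Representable : (ℕ → ℕ) → Set
Representable f = Σ Germ λ a → ⟦ a ⟧ ≈ f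

opaque
  unfolding ⟦_⟧
  represent : ∀ p f → Eventually (λ k → ⟪ p ⟫ k ≡ + f k) → Representable f
  represent p f eq =
    -- Idempotence of `norm` follows from uniqueness, because `norm p` and `p` eventually have the
    -- same values.
    germ (norm p) (norm-unique (norm p) p (⟪norm⟫ p))
      (isNonNegative-complete (norm p) (ev-map (λ k e → subst (0ℤ ℤ.≤_) (sym e) (ℤ.+≤+ z≤n)) norm≡)) ,
    ev-map (λ _ → cong ∣_∣) norm≡
    where
    norm≡ : Eventually (λ k → ⟪ norm p ⟫ k ≡ + f k)
    norm≡ = ev-zip (λ _ → trans) (⟪norm⟫ p) eq

opaque
  constant-representable : ∀ n → Representable (λ _ → n)
  constant-representable n = represent (constantᴿ (+ n)) _ (always (⟪constantᴿ⟫ (+ n)))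

opaque
  2^-representable : Representable (2 ^_)
  2^-representable = represent Xᴿ _ (always (λ k → trans (⟪Xᴿ⟫ k) (pow≡ k)))

opaque
  +-representable : ∀ a b → Representable (λ k → ⟦ a ⟧ k + ⟦ b ⟧ k)
  +-representable a b = represent (code a +ᴿ code b) _ (ev-zip (λ k e (p , q) → trans e (cong₂ ℤ._+_ p q))
    (⟪+ᴿ⟫ (code a) (code b)) (ev-and (code-nonNegative a) (code-nonNegative b)))

opaque
  *-representable : ∀ a b → Representable (λ k → ⟦ a ⟧ k * ⟦ b ⟧ k)
  *-representable a b = represent (code a *ᴿ code b) _
    (ev-zip (λ k e (p , q) → trans e (trans (cong₂ ℤ._*_ p q) (sym (ℤₚ.pos-* (⟦ a ⟧ k) (⟦ b ⟧ k)))))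
      (⟪*ᴿ⟫ (code a) (code b)) (ev-and (code-nonNegative a) (code-nonNegative b)))

difference : Germ → Germ → Raw
difference a b = code b +ᴿ (-ᴿ code a)

⟪difference⟫ : ∀ a b → Eventually (λ k → ⟪ difference a b ⟫ k ≡ + ⟦ b ⟧ k ℤ.- + ⟦ a ⟧ k)
⟪difference⟫ a b = ev-zip (λ k e (p , q) → trans e (cong₂ ℤ._+_ q (trans (⟪-ᴿ⟫ (code a) k) (cong ℤ.-_ p))))
  (⟪+ᴿ⟫ (code b) (-ᴿ code a)) (ev-and (code-nonNegative a) (code-nonNegative b))

opaque
  ∸-representable : ∀ a b → Eventually (λ k → ⟦ a ⟧ k ≤ ⟦ b ⟧ k) → Representable (λ k → ⟦ b ⟧ k ∸ ⟦ a ⟧ k)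
  ∸-representable a b le = represent (difference a b) _
    (ev-zip (λ k e le → trans e (trans (ℤₚ.m-n≡m⊖n (⟦ b ⟧ k) (⟦ a ⟧ k)) (ℤₚ.⊖-≥ le))) (⟪difference⟫ a b) le)

opaque
  half-representable : ∀ a f → ⟦ a ⟧ ≈ (λ k → 2 * f k) → Representable f
  half-representable a f eq with halved (code a) (λ k → + f k)
    (ev-zip (λ k e p → trans p (trans (cong +_ e) (ℤₚ.pos-* 2 (f k)))) eq (code-nonNegative a))
  ... | q , eq′ = represent q f eq′

j+[i-j]≡i : ∀ i j → j ℤ.+ (i ℤ.- j) ≡ i
j+[i-j]≡i i j = solve (i ∷ j ∷ [])

data Order (a b : Germ) : Set where
  less    : Eventually (λ k → ⟦ a ⟧ k < ⟦ b ⟧ k) → Order a b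
  equal   : a ≡ b → Order a b
  greater : Eventually (λ k → ⟦ b ⟧ k < ⟦ a ⟧ k) → Order a b

opaque
  -- The sign of the difference decides. This trichotomy makes atomic formulas decidable in the
  -- model.
  compare : ∀ a b → Order a b
  compare a b with raw-sign (difference a b)
  ... | vanishing ≡0 = equal (≈⇒≡ a b (ev-zip (λ k e d → sym (ℤₚ.+-injective (ℤₚ.i-j≡0⇒i≡j (+ ⟦ b ⟧ k) (+ ⟦ a ⟧ k) (trans (sym d) e))))
          ≡0 (⟪difference⟫ a b)))
  ... | positive μ = less (ev-zip (λ k lt d → ℤₚ.drop‿+<+ (subst₂ ℤ._<_ (ℤₚ.+-identityʳ (+ ⟦ a ⟧ k)) (j+[i-j]≡i (+ ⟦ b ⟧ k) (+ ⟦ a ⟧ k))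
            (ℤₚ.+-monoʳ-< (+ ⟦ a ⟧ k) (subst (0ℤ ℤ.<_) d lt))))
          (magnitude-positive μ) (⟪difference⟫ a b))
  ... | negative <0 = greater (ev-zip (λ k lt d → ℤₚ.drop‿+<+ (subst₂ ℤ._<_ (j+[i-j]≡i (+ ⟦ b ⟧ k) (+ ⟦ a ⟧ k)) (ℤₚ.+-identityʳ (+ ⟦ a ⟧ k))
            (ℤₚ.+-monoʳ-< (+ ⟦ a ⟧ k) (subst (ℤ._< 0ℤ) d lt))))
          <0 (⟪difference⟫ a b))


-- Monomials, dyadic bounds and odd cofactors

-- The element 2ᵇ⁻ᵗ Xᵐ; the factor `2 ^ t` stands on the left so that `b < t` is allowed.
Monomial : (m b t : ℕ) → (ℕ → ℕ) → Set
Monomial m b t f = Eventually (λ k → 2 ^ t * f k ≡ 2 ^ (m * k + b))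

opaque
  2^-linear-representable : ∀ m b → Representable (λ k → 2 ^ (m * k + b))
  2^-linear-representable zero    b = constant-representable (2 ^ b)
  2^-linear-representable (suc m) b with 2^-representable | 2^-linear-representable m b
  ... | x , x≈ | y , y≈ with *-representable x y
  ...   | z , z≈ = z , ≈-trans z≈ (ev-zip (λ k p q → trans (cong₂ _*_ p q) (trans (sym (ℕₚ.^-distribˡ-+-* 2 k (m * k + b)))
          (cong (2 ^_) (sym (ℕₚ.+-assoc k (m * k) b))))) x≈ y≈)

linear-unbounded : ∀ {m} b t → 1 ≤ m → Eventually (λ k → t ≤ m * k + b)
linear-unbounded {suc m} b t _ = ev-map (λ k le → ℕₚ.≤-trans le (ℕₚ.≤-trans (ℕₚ.m≤m+n k (m * k)) (ℕₚ.m≤m+n (k + m * k) b))) (ev-≥ t)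

opaque
  -- One halving per unit of `t`. Since `1 ≤ m`, the exponent eventually exceeds `t`, so the
  -- truncated subtraction is a true one there.
  shifted-representable : ∀ m b t → 1 ≤ m → Representable (λ k → 2 ^ (m * k + b ∸ t))
  shifted-representable m b zero    1≤m = 2^-linear-representable m b
  shifted-representable m b (suc t) 1≤m with shifted-representable m b t 1≤m
  ... | a , a≈ = half-representable a _ (≈-trans a≈
        (ev-map (λ k lt → cong (2 ^_) (ℕₚ.+-∸-assoc 1 lt)) (linear-unbounded b (suc t) 1≤m)))

opaque
  -- The condition on `t` and `m` keeps denominators away from constants: a constant power of two
  -- stays whole, while a positive power of X can be halved any number of times.
  monomial : ∀ m b t → t ≡ 0 ⊎ 1 ≤ m → ∃[ a ] Monomial m b t ⟦ a ⟧
  monomial m b .0 (inj₁ refl) = let a , a≈ = 2^-linear-representable m b in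
    a , ev-map (λ k e → trans (ℕₚ.*-identityˡ (⟦ a ⟧ k)) e) a≈
  monomial m b t (inj₂ 1≤m) = let a , a≈ = shifted-representable m b t 1≤m in
    a , ev-zip (λ k e le → trans (cong (2 ^ t *_) e) (trans (sym (ℕₚ.^-distribˡ-+-* 2 t (m * k + b ∸ t)))
          (cong (2 ^_) (ℕₚ.m+[n∸m]≡n le)))) a≈ (linear-unbounded b t 1≤m)

pow*+ : ∀ t n → pow t ℤ.* + n ≡ + (2 ^ t * n)
pow*+ t n = trans (cong (ℤ._* + n) (pow≡ t)) (sym (ℤₚ.pos-* (2 ^ t) n))

opaque
  unfolding ⟦_⟧
  -- The magnitude of the code, restated in ℕ. The lower bound is weak so that it also covers the
  -- exact case.
  floor-power : ∀ a → Eventually (λ k → 0 < ⟦ a ⟧ k) → ∃[ m ] ∃[ b ] ∃[ t ] (t ≡ 0 ⊎ 1 ≤ m) ×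
    Eventually (λ k → 2 ^ (m * k + b) ≤ 2 ^ t * ⟦ a ⟧ k × 2 ^ t * ⟦ a ⟧ k < 2 * 2 ^ (m * k + b))
  floor-power a a>0 with raw-sign (code a)
  ... | vanishing ≡0 = ⊥-elim (ev-absurd (λ k lt e → ℕₚ.<⇒≢ lt (sym (cong ∣_∣ e))) a>0 ≡0)
  ... | negative <0  = ⊥-elim (ev-absurd (λ k e lt → ℤₚ.<⇒≱ lt (subst (0ℤ ℤ.≤_) (sym e) (ℤ.+≤+ z≤n))) (code-nonNegative a) <0)
  ... | positive (magnitude m b t shape bounds) = m , b , t , shape , conclude bounds
    where
    convert : ∀ k → ⟪ code a ⟫ k ≡ + ⟦ a ⟧ k → pow t ℤ.* ⟪ code a ⟫ k ≡ + (2 ^ t * ⟦ a ⟧ k)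
    convert k e = trans (cong (ℤ._*_ (pow t)) e) (pow*+ t (⟦ a ⟧ k))
    conclude : Eventually (λ k → pow t ℤ.* ⟪ code a ⟫ k ≡ pow (m * k + b))
             ⊎ Eventually (λ k → pow (m * k + b) ℤ.< pow t ℤ.* ⟪ code a ⟫ k
                               × pow t ℤ.* ⟪ code a ⟫ k ℤ.< + 2 ℤ.* pow (m * k + b)) →
      Eventually (λ k → 2 ^ (m * k + b) ≤ 2 ^ t * ⟦ a ⟧ k × 2 ^ t * ⟦ a ⟧ k < 2 * 2 ^ (m * k + b))
    conclude (inj₁ exact) = ev-zip (λ k e p →
        let eq = ℤₚ.+-injective (trans (sym (convert k p)) (trans e (pow≡ (m * k + b)))) in
        ℕₚ.≤-reflexive (sym eq) , subst (_< 2 * 2 ^ (m * k + b)) (sym eq)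
          (ℕₚ.^-monoʳ-< 2 (s≤s (s≤s z≤n)) (ℕₚ.n<1+n (m * k + b))))
      exact (code-nonNegative a)
    conclude (inj₂ strict) = ev-zip (λ k (lo , hi) p →
        ℕₚ.<⇒≤ (ℤₚ.drop‿+<+ (subst₂ ℤ._<_ (pow≡ (m * k + b)) (convert k p) lo)) ,
        ℤₚ.drop‿+<+ (subst₂ ℤ._<_ (convert k p)
          (trans (sym (pow-suc (m * k + b))) (pow≡ (suc (m * k + b)))) hi))
      strict (code-nonNegative a)

opaque
  unfolding ⟦_⟧
  -- Positivity excludes the zero case of `factorize`. The odd cofactor is a germ because a power of
  -- two times it equals a nonnegative value, so it is eventually nonnegative itself.
  factor-odd : ∀ a → Eventually (λ k → 0 < ⟦ a ⟧ k) → ∃[ m ] ∃[ b ] ∃[ t ] (t ≡ 0 ⊎ 1 ≤ m) ×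
    ∃[ q ] (∀ (f : ℕ → ℕ) → ¬ ⟦ q ⟧ ≈ (λ k → 2 * f k)) × Eventually (λ k → 2 ^ t * ⟦ a ⟧ k ≡ 2 ^ (m * k + b) * ⟦ q ⟧ k)
  factor-odd a a>0 with factorize (code a)
  ... | inj₁ ≡0 = ⊥-elim (ev-absurd (λ k lt e → ℕₚ.<⇒≢ lt (sym (cong ∣_∣ e))) a>0 ≡0)
  ... | inj₂ (factorization m b t shape q q-odd eq) = m , b , t , shape , q′ , odd , equation
    where
    nonNeg : Eventually (λ k → ⟪ q ⟫ k ≡ + ∣ ⟪ q ⟫ k ∣)
    nonNeg = ev-zip (λ k e p → sym (ℤₚ.0≤i⇒+∣i∣≡i (ℤₚ.*-cancelˡ-≤-pos 0ℤ (⟪ q ⟫ k) (pow (m * k + b)) {{pow-positive {m * k + b}}}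
        (subst₂ ℤ._≤_ (sym (ℤₚ.*-zeroʳ (pow (m * k + b)))) (trans (sym (pow*+ t (⟦ a ⟧ k))) (trans (cong (ℤ._*_ (pow t)) (sym p)) e))
          (ℤ.+≤+ z≤n)))))
      eq (code-nonNegative a)
    rep : Representable (λ k → ∣ ⟪ q ⟫ k ∣)
    rep = represent q (λ k → ∣ ⟪ q ⟫ k ∣) nonNeg
    q′ : Germ
    q′ = proj₁ rep
    q≡ : Eventually (λ k → ⟪ q ⟫ k ≡ + ⟦ q′ ⟧ k)
    q≡ = ev-zip (λ k e p → trans e (cong +_ (sym p))) nonNeg (proj₂ rep)
    odd : ∀ (f : ℕ → ℕ) → ¬ ⟦ q′ ⟧ ≈ (λ k → 2 * f k)
    odd f even = odd-not-even {q} (λ k → + f k) q-odd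
      (ev-zip (λ k e p → trans e (trans (cong +_ p) (ℤₚ.pos-* 2 (f k)))) q≡ even)
    equation : Eventually (λ k → 2 ^ t * ⟦ a ⟧ k ≡ 2 ^ (m * k + b) * ⟦ q′ ⟧ k)
    equation = ev-zip (λ k e (p , r) → ℤₚ.+-injective (trans (sym (pow*+ t (⟦ a ⟧ k))) (trans (cong (ℤ._*_ (pow t)) (sym p))
        (trans e (trans (cong (ℤ._*_ (pow (m * k + b))) r) (pow*+ (m * k + b) (⟦ q′ ⟧ k)))))))
      eq (ev-and (code-nonNegative a) q≡)

-- Transfer of universal sentences

-- Opened here because overloaded list constructors would make every call of the ring solver ambiguous.
open import Data.Vec as Vec using (Vec; []; _∷_)
open import Data.Vec.Properties using (lookup-map)

opaque
  0ᴳ 1ᴳ 2^ᴳ : Germ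
  0ᴳ  = proj₁ (constant-representable 0)
  1ᴳ  = proj₁ (constant-representable 1)
  2^ᴳ = proj₁ 2^-representable

  infixl 6 _+ᴳ_
  infixl 7 _*ᴳ_

  _+ᴳ_ _*ᴳ_ : Germ → Germ → Germ
  a +ᴳ b = proj₁ (+-representable a b)
  a *ᴳ b = proj₁ (*-representable a b)

  ⟦0⟧ : ⟦ 0ᴳ ⟧ ≈ λ _ → 0
  ⟦0⟧ = proj₂ (constant-representable 0)

  ⟦1⟧ : ⟦ 1ᴳ ⟧ ≈ λ _ → 1
  ⟦1⟧ = proj₂ (constant-representable 1)

  ⟦2^⟧ : ⟦ 2^ᴳ ⟧ ≈ (2 ^_)
  ⟦2^⟧ = proj₂ 2^-representable

  ⟦+⟧ : ∀ a b → ⟦ a +ᴳ b ⟧ ≈ λ k → ⟦ a ⟧ k + ⟦ b ⟧ k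
  ⟦+⟧ a b = proj₂ (+-representable a b)

  ⟦*⟧ : ∀ a b → ⟦ a *ᴳ b ⟧ ≈ λ k → ⟦ a ⟧ k * ⟦ b ⟧ k
  ⟦*⟧ a b = proj₂ (*-representable a b)

infix 4 _≤ᴳ_
_≤ᴳ_ : Germ → Germ → Set
a ≤ᴳ b = Eventually (λ k → ⟦ a ⟧ k ≤ ⟦ b ⟧ k)

𝔊 : Structure
𝔊 = record
  { Carrier = Germ
  ; 0#      = 0ᴳ
  ; 1#      = 1ᴳ
  ; _+_     = _+ᴳ_
  ; _*_     = _*ᴳ_
  ; _≤_     = _≤ᴳ_
  }

at : ∀ {n} → ℕ → Vec Germ n → Vec ℕ n
at k = Vec.map (λ a → ⟦ a ⟧ k)

⟦eval⟧ : ∀ {n} (ρ : Vec Germ n) t → ⟦ eval 𝔊 ρ t ⟧ ≈ λ k → eval 𝔑₀ (at k ρ) t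
⟦eval⟧ ρ (var i) = always (λ k → sym (lookup-map i (λ a → ⟦ a ⟧ k) ρ))
⟦eval⟧ ρ 𝟘       = ⟦0⟧
⟦eval⟧ ρ 𝟙       = ⟦1⟧
⟦eval⟧ ρ (s ⊕ t) = ≈-trans (⟦+⟧ (eval 𝔊 ρ s) (eval 𝔊 ρ t)) (ev-zip (λ _ → cong₂ _+_) (⟦eval⟧ ρ s) (⟦eval⟧ ρ t))
⟦eval⟧ ρ (s ⊗ t) = ≈-trans (⟦*⟧ (eval 𝔊 ρ s) (eval 𝔊 ρ t)) (ev-zip (λ _ → cong₂ _*_) (⟦eval⟧ ρ s) (⟦eval⟧ ρ t))

-- A counterpart of Łoś's theorem for eventual truth: the verdict in the model comes with the same
-- verdict at all large `k`. Carrying both verdicts lets the induction pass through implications.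
data Decided {n} (ρ : Vec Germ n) (φ : Formula n) : Set where
  holds : Satisfies 𝔊 ρ φ → Eventually (λ k → Satisfies 𝔑₀ (at k ρ) φ) → Decided ρ φ
  fails : ¬ Satisfies 𝔊 ρ φ → Eventually (λ k → ¬ Satisfies 𝔑₀ (at k ρ) φ) → Decided ρ φ

equality-decided : ∀ {n} (ρ : Vec Germ n) s t → Decided ρ (s ≐ t)
equality-decided ρ s t with compare (eval 𝔊 ρ s) (eval 𝔊 ρ t)
... | equal eq   = holds eq (≈-trans (≈-sym (⟦eval⟧ ρ s)) (≈-trans (always (λ k → cong (λ a → ⟦ a ⟧ k) eq)) (⟦eval⟧ ρ t)))
... | less lt    = fails (λ eq → ev-absurd {P = λ _ → 0 ≡ 0} (λ k _ l → ℕₚ.<⇒≢ l (cong (λ a → ⟦ a ⟧ k) eq)) (always (λ _ → refl)) lt)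
                     (ev-zip (λ k l (p , q) → ℕₚ.<⇒≢ (subst₂ _<_ p q l)) lt (ev-and (⟦eval⟧ ρ s) (⟦eval⟧ ρ t)))
... | greater gt = fails (λ eq → ev-absurd {P = λ _ → 0 ≡ 0} (λ k _ l → ℕₚ.>⇒≢ l (cong (λ a → ⟦ a ⟧ k) eq)) (always (λ _ → refl)) gt)
                     (ev-zip (λ k l (p , q) → ℕₚ.>⇒≢ (subst₂ _<_ q p l)) gt (ev-and (⟦eval⟧ ρ s) (⟦eval⟧ ρ t)))

inequality-decided : ∀ {n} (ρ : Vec Germ n) s t → Decided ρ (s ≼ t)
inequality-decided ρ s t with compare (eval 𝔊 ρ s) (eval 𝔊 ρ t)
... | equal eq   = holds le (ev-zip (λ k l (p , q) → subst₂ _≤_ p q l) le (ev-and (⟦eval⟧ ρ s) (⟦eval⟧ ρ t)))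
  where
  le : eval 𝔊 ρ s ≤ᴳ eval 𝔊 ρ t
  le = always (λ k → ℕₚ.≤-reflexive (cong (λ a → ⟦ a ⟧ k) eq))
... | less lt    = holds (ev-map (λ _ → ℕₚ.<⇒≤) lt)
                     (ev-zip (λ k l (p , q) → ℕₚ.<⇒≤ (subst₂ _<_ p q l)) lt (ev-and (⟦eval⟧ ρ s) (⟦eval⟧ ρ t)))
... | greater gt = fails (λ le → ev-absurd (λ _ → ℕₚ.<⇒≱) gt le)
                     (ev-zip (λ k l (p , q) → ℕₚ.<⇒≱ (subst₂ _<_ q p l)) gt (ev-and (⟦eval⟧ ρ s) (⟦eval⟧ ρ t)))

decide : ∀ {n} (ρ : Vec Germ n) {φ} → QuantifierFree φ → Decided ρ φ
decide ρ (s ≐ t) = equality-decided ρ s t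
decide ρ (s ≼ t) = inequality-decided ρ s t
decide ρ ⊥′      = fails (λ ()) (always (λ _ ()))
decide ρ (φ ∧′ ψ) with decide ρ φ | decide ρ ψ
... | holds p p′ | holds q q′ = holds (p , q) (ev-and p′ q′)
... | fails p p′ | _          = fails (p ∘ proj₁) (ev-map (λ _ → _∘ proj₁) p′)
... | holds _ _  | fails q q′ = fails (q ∘ proj₂) (ev-map (λ _ → _∘ proj₂) q′)
decide ρ (φ ∨′ ψ) with decide ρ φ | decide ρ ψ
... | holds p p′ | _          = holds (inj₁ p) (ev-map (λ _ → inj₁) p′)
... | fails _ _  | holds q q′ = holds (inj₂ q) (ev-map (λ _ → inj₂) q′)
... | fails p p′ | fails q q′ = fails Sum.[ p , q ] (ev-zip (λ _ → Sum.[_,_]) p′ q′)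
decide ρ (φ ⇒ ψ) with decide ρ φ | decide ρ ψ
... | fails p p′ | _          = holds (⊥-elim ∘ p) (ev-map (λ _ → ⊥-elim ∘_) p′)
... | holds _ _  | holds q q′ = holds (λ _ → q) (ev-map (λ _ q _ → q) q′)
... | holds p p′ | fails q q′ = fails (λ f → q (f p)) (ev-zip (λ _ p ¬q f → ¬q (f p)) p′ q′)

closure-intro : ∀ 𝔄 {n} {φ : Formula n} → (∀ ρ → Satisfies 𝔄 ρ φ) → 𝔄 ⊨ closure φ
closure-intro 𝔄 {zero}  h = h []
closure-intro 𝔄 {suc n} h = closure-intro 𝔄 {n} (λ ρ a → h (a ∷ ρ))

closure-elim : ∀ 𝔄 {n} {φ : Formula n} → 𝔄 ⊨ closure φ → ∀ ρ → Satisfies 𝔄 ρ φ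
closure-elim 𝔄 {zero}  h []      = h
closure-elim 𝔄 {suc n} h (a ∷ ρ) = closure-elim 𝔄 {n} h ρ a

-- If the matrix failed for some germs, it would fail in ℕ for their values at a single large `k`,
-- against validity there.
transfer : ∀ {φ} → Universal φ → 𝔑₀ ⊨ φ → 𝔊 ⊨ φ
transfer (universal {φ = φ} qf) valid = closure-intro 𝔊 {φ = φ} λ ρ → conclude ρ (decide ρ qf)
  where
  conclude : ∀ ρ → Decided ρ φ → Satisfies 𝔊 ρ φ
  conclude ρ (holds p _)  = p
  conclude ρ (fails _ ¬φ) = ⊥-elim (proj₂ (ev-witness ¬φ) (closure-elim 𝔑₀ {φ = φ} valid (at _ ρ)))

-- Powers of two

-- By Euclid's lemma either `y` is even, or `n` is and a factor two cancels, which lowers `e`. At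
-- `e = 0` the product is 1, against `1 < y`.
2∣divisor-of-2^ : ∀ e n y → n * y ≡ 2 ^ e → 1 < y → 2 ∣ y
2∣divisor-of-2^ zero n y eq 1<y = contradiction (ℕₚ.m*n≡1⇒n≡1 n y eq) (ℕₚ.>⇒≢ 1<y)
2∣divisor-of-2^ (suc e) n y eq 1<y
  with euclidsLemma n y prime[2] (divides (2 ^ e) (trans eq (ℕₚ.*-comm 2 (2 ^ e))))
... | inj₂ 2∣y = 2∣y
... | inj₁ (divides q n≡q*2) = 2∣divisor-of-2^ e q y (ℕₚ.*-cancelˡ-≡ (q * y) (2 ^ e) 2 (begin
    2 * (q * y)  ≡⟨ ℕₚ.*-assoc 2 q y ⟨
    2 * q * y    ≡⟨ cong (_* y) (ℕₚ.*-comm 2 q) ⟩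
    q * 2 * y    ≡⟨ cong (_* y) n≡q*2 ⟨
    n * y        ≡⟨ eq ⟩
    2 ^ suc e    ∎)) 1<y
  where open ≡-Reasoning

infix 4 _∣ᴳ_
_∣ᴳ_ : Germ → Germ → Set
a ∣ᴳ b = Σ Germ λ c → c *ᴳ a ≡ b

-- This is what `pow₂` unfolds to in `𝔊`, so facts about it serve pa19 and pa20 directly.
Pow₂ : Germ → Set
Pow₂ a = ∀ b → b ∣ᴳ a → b ≡ 1ᴳ ⊎ 1ᴳ +ᴳ 1ᴳ ∣ᴳ b

⟦*2⟧ : ∀ a → ⟦ a *ᴳ (1ᴳ +ᴳ 1ᴳ) ⟧ ≈ λ k → 2 * ⟦ a ⟧ k
⟦*2⟧ a = ≈-trans (⟦*⟧ a (1ᴳ +ᴳ 1ᴳ)) (ev-zip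
  (λ k e p → trans (cong (⟦ a ⟧ k *_) (trans e (cong₂ _+_ p p))) (ℕₚ.*-comm (⟦ a ⟧ k) 2)) (⟦+⟧ 1ᴳ 1ᴳ) ⟦1⟧)

≡-germ : ∀ {a b} → a ≡ b → ⟦ a ⟧ ≈ ⟦ b ⟧
≡-germ refl = always (λ _ → refl)

even-∣ᴳ : ∀ a f → ⟦ a ⟧ ≈ (λ k → 2 * f k) → 1ᴳ +ᴳ 1ᴳ ∣ᴳ a
even-∣ᴳ a f eq = let b , b≈ = half-representable a f eq in
  b , ≈⇒≡ _ a (≈-trans (⟦*2⟧ b) (≈-trans (ev-map (λ _ → cong (2 *_)) b≈) (≈-sym eq)))

∣ᴳ-even : ∀ a → 1ᴳ +ᴳ 1ᴳ ∣ᴳ a → ∃[ f ] ⟦ a ⟧ ≈ (λ k → 2 * f k)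
∣ᴳ-even a (b , eq) = ⟦ b ⟧ , ≈-trans (≈-sym (≡-germ eq)) (⟦*2⟧ b)

0<-*ʳ : ∀ m n → 0 < m * n → 0 < n
0<-*ʳ m zero    lt = subst (0 <_) (ℕₚ.*-zeroʳ m) lt
0<-*ʳ m (suc n) lt = s≤s z≤n

cofactor : ∀ m b t {a} z y → Monomial m b t ⟦ a ⟧ → z *ᴳ y ≡ a →
  Eventually (λ k → 2 ^ t * ⟦ z ⟧ k * ⟦ y ⟧ k ≡ 2 ^ (m * k + b))
cofactor m b t z y mono zy≡a = ev-zip
  (λ k e (p , q) → trans (ℕₚ.*-assoc (2 ^ t) (⟦ z ⟧ k) (⟦ y ⟧ k)) (trans (cong (2 ^ t *_) (trans (sym q) p)) e))
  mono (ev-and (≡-germ zy≡a) (⟦*⟧ z y))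

-- At each large `k` the value of a divisor `y` divides a power of two, so it is positive, and it is
-- even if it exceeds 1. `compare` makes the choice between 1 and larger values uniform in `k`.
monomial⇒pow₂ : ∀ m b t a → Monomial m b t ⟦ a ⟧ → Pow₂ a
monomial⇒pow₂ m b t a mono y (z , zy≡a) with compare y 1ᴳ
... | equal eq   = inj₁ eq
... | less lt    = ⊥-elim (ev-absurd (λ k (e , one) l → ℕₚ.<⇒≱ l (ℕₚ.≤-trans (ℕₚ.≤-reflexive one)
        (0<-*ʳ (2 ^ t * ⟦ z ⟧ k) (⟦ y ⟧ k) (subst (0 <_) (sym e) (ℕₚ.m^n>0 2 (m * k + b))))))
      (ev-and (cofactor m b t z y mono zy≡a) ⟦1⟧) lt)
-- The half is only a pointwise quotient at first; `even-∣ᴳ` turns it into a germ.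
... | greater gt = inj₂ (even-∣ᴳ y (λ k → ⟦ y ⟧ k / 2) (ev-zip
        (λ k (e , one) l → sym (m*[n/m]≡n (2∣divisor-of-2^ (m * k + b) (2 ^ t * ⟦ z ⟧ k) (⟦ y ⟧ k) e (subst (_< ⟦ y ⟧ k) one l))))
      (ev-and (cofactor m b t z y mono zy≡a) ⟦1⟧) gt))

¬2∣3 : ¬ 2 ∣ 3
¬2∣3 = from-no (2 ∣? 3)

-- Everything divides zero, in particular three, which is neither 1 nor even.
3-not-divisor : ∀ a b → ⟦ a ⟧ ≈ (λ _ → 0) → ⟦ b ⟧ ≈ (λ _ → 3) → ¬ Pow₂ a
3-not-divisor a b a≈0 b≈3 pow with pow b (0ᴳ , ≈⇒≡ (0ᴳ *ᴳ b) a (≈-trans (⟦*⟧ 0ᴳ b)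
    (ev-zip (λ k p q → trans (cong (_* ⟦ b ⟧ k) p) (sym q)) ⟦0⟧ a≈0)))
... | inj₁ b≡1 = ev-absurd (λ k p q → ℕₚ.>⇒≢ {3} {1} (s≤s (s≤s z≤n)) (trans (sym p) q)) b≈3 (≈-trans (≡-germ b≡1) ⟦1⟧)
... | inj₂ 2∣b = let f , even = ∣ᴳ-even b 2∣b in
    ev-absurd (λ k p q → ¬2∣3 (divides (f k) (trans (trans (sym p) q) (ℕₚ.*-comm 2 (f k))))) b≈3 even

¬pow₂-0 : ∀ a → ⟦ a ⟧ ≈ (λ _ → 0) → ¬ Pow₂ a
¬pow₂-0 a a≈0 = let three , eq = constant-representable 3 in 3-not-divisor a three a≈0 eq

-- The odd cofactor `q` of `a` is a divisor of `a`, with a monomial as quotient. Not being even, it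
-- must be 1, and `a` is the monomial.
pow₂⇒monomial : ∀ a → Pow₂ a → ∃[ m ] ∃[ b ] ∃[ t ] (t ≡ 0 ⊎ 1 ≤ m) × Monomial m b t ⟦ a ⟧
pow₂⇒monomial a pow with compare a 0ᴳ
... | less lt    = ⊥-elim (ev-absurd (λ k z l → ℕₚ.n≮0 (subst (⟦ a ⟧ k <_) z l)) ⟦0⟧ lt)
... | equal refl = ⊥-elim (¬pow₂-0 0ᴳ ⟦0⟧ pow)
... | greater gt with factor-odd a (ev-zip (λ k z l → subst (_< ⟦ a ⟧ k) z l) ⟦0⟧ gt)
...   | m , b , t , shape , q , odd , eq with monomial m b t shape
...     | c , c-mono with pow q (c , ≈⇒≡ _ a (≈-trans (⟦*⟧ c q) (ev-zip (λ k e p → ℕₚ.*-cancelˡ-≡ (⟦ c ⟧ k * ⟦ q ⟧ k) (⟦ a ⟧ k) (2 ^ t) {{2^-nonZero {t}}}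
            (trans (sym (ℕₚ.*-assoc (2 ^ t) (⟦ c ⟧ k) (⟦ q ⟧ k))) (trans (cong (_* ⟦ q ⟧ k) p) (sym e)))) eq c-mono)))
...       | inj₂ 2∣q  = let f , even = ∣ᴳ-even q 2∣q in contradiction even (odd f)
...       | inj₁ refl = m , b , t , shape , ev-zip (λ k e one → trans e (trans (cong (2 ^ (m * k + b) *_) one) (ℕₚ.*-identityʳ (2 ^ (m * k + b))))) eq ⟦1⟧

2^-cancel-≤ : ∀ m n → 2 ^ m ≤ 2 ^ n → m ≤ n
2^-cancel-≤ m n le = ℕₚ.≮⇒≥ (λ n<m → ℕₚ.<⇒≱ (ℕₚ.^-monoʳ-< 2 (s≤s (s≤s z≤n)) n<m) le)

module _ m b t m′ b′ t′ {x y : Germ} (x-mono : Monomial m b t ⟦ x ⟧) (y-mono : Monomial m′ b′ t′ ⟦ y ⟧) where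

  exponents-≤ : x ≤ᴳ y → Eventually (λ k → m * k + (b + t′) ≤ m′ * k + (b′ + t))
  exponents-≤ x≤y = ev-zip (λ k le (p , q) → 2^-cancel-≤ (m * k + (b + t′)) (m′ * k + (b′ + t)) (begin
      2 ^ (m * k + (b + t′))          ≡⟨ cong (2 ^_) (ℕₚ.+-assoc (m * k) b t′) ⟨
      2 ^ (m * k + b + t′)            ≡⟨ ℕₚ.^-distribˡ-+-* 2 (m * k + b) t′ ⟩
      2 ^ (m * k + b) * 2 ^ t′        ≡⟨ cong (_* 2 ^ t′) p ⟨
      2 ^ t * ⟦ x ⟧ k * 2 ^ t′        ≤⟨ ℕₚ.*-monoˡ-≤ (2 ^ t′) (ℕₚ.*-monoʳ-≤ (2 ^ t) le) ⟩
      2 ^ t * ⟦ y ⟧ k * 2 ^ t′        ≡⟨ rotate (2 ^ t) (⟦ y ⟧ k) (2 ^ t′) ⟩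
      2 ^ t′ * ⟦ y ⟧ k * 2 ^ t        ≡⟨ cong (_* 2 ^ t) q ⟩
      2 ^ (m′ * k + b′) * 2 ^ t       ≡⟨ ℕₚ.^-distribˡ-+-* 2 (m′ * k + b′) t ⟨
      2 ^ (m′ * k + b′ + t)           ≡⟨ cong (2 ^_) (ℕₚ.+-assoc (m′ * k) b′ t) ⟩
      2 ^ (m′ * k + (b′ + t))         ∎)) x≤y (ev-and x-mono y-mono)
    where
    open ℕₚ.≤-Reasoning
    rotate : ∀ a b c → a * b * c ≡ c * b * a
    rotate = solve-∀

  -- Dividing 2 to the `b′ - t′` times the higher power of X by 2 to the `b - t` times the lower one
  -- leaves degree `d` and the dyadic factor with numerator exponent `b′ + t` and denominator
  -- exponent `b + t′`.
  quotient : ∀ d → d + m ≡ m′ → (z : Germ) → Monomial d (b′ + t) (b + t′) ⟦ z ⟧ → x ∣ᴳ y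
  quotient d refl z z-mono = z , ≈⇒≡ (z *ᴳ x) y (ev-zip (λ k e (p , q , r) →
      ℕₚ.*-cancelˡ-≡ (⟦ z *ᴳ x ⟧ k) (⟦ y ⟧ k) (2 ^ (b + t′ + t)) {{2^-nonZero {b + t′ + t}}} (begin
        2 ^ (b + t′ + t) * ⟦ z *ᴳ x ⟧ k                ≡⟨ cong₂ _*_ (ℕₚ.^-distribˡ-+-* 2 (b + t′) t) e ⟩
        2 ^ (b + t′) * 2 ^ t * (⟦ z ⟧ k * ⟦ x ⟧ k)      ≡⟨ interchange (2 ^ (b + t′)) (2 ^ t) (⟦ z ⟧ k) (⟦ x ⟧ k) ⟩
        2 ^ (b + t′) * ⟦ z ⟧ k * (2 ^ t * ⟦ x ⟧ k)      ≡⟨ cong₂ _*_ r p ⟩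
        2 ^ (d * k + (b′ + t)) * 2 ^ (m * k + b)       ≡⟨ ℕₚ.^-distribˡ-+-* 2 (d * k + (b′ + t)) (m * k + b) ⟨
        2 ^ (d * k + (b′ + t) + (m * k + b))           ≡⟨ cong (2 ^_) (exponents d m k b b′ t) ⟩
        2 ^ (b + t + ((d + m) * k + b′))               ≡⟨ ℕₚ.^-distribˡ-+-* 2 (b + t) ((d + m) * k + b′) ⟩
        2 ^ (b + t) * 2 ^ ((d + m) * k + b′)           ≡⟨ cong (2 ^ (b + t) *_) q ⟨
        2 ^ (b + t) * (2 ^ t′ * ⟦ y ⟧ k)               ≡⟨ ℕₚ.*-assoc (2 ^ (b + t)) (2 ^ t′) (⟦ y ⟧ k) ⟨
        2 ^ (b + t) * 2 ^ t′ * ⟦ y ⟧ k                 ≡⟨ cong (_* ⟦ y ⟧ k) (ℕₚ.^-distribˡ-+-* 2 (b + t) t′) ⟨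
        2 ^ (b + t + t′) * ⟦ y ⟧ k                     ≡⟨ cong (λ e → 2 ^ e * ⟦ y ⟧ k) (swap b t t′) ⟩
        2 ^ (b + t′ + t) * ⟦ y ⟧ k                     ∎))
    (⟦*⟧ z x) (ev-and x-mono (ev-and y-mono z-mono)))
    where
    open ≡-Reasoning
    interchange : ∀ a b c d → a * b * (c * d) ≡ a * c * (b * d)
    interchange = solve-∀
    exponents : ∀ d m k b b′ t → d * k + (b′ + t) + (m * k + b) ≡ b + t + ((d + m) * k + b′)
    exponents = solve-∀
    swap : ∀ b t t′ → b + t + t′ ≡ b + t′ + t
    swap = solve-∀

  -- If the degree of `y` is larger, the quotient has positive degree and tolerates any denominator.
  -- A smaller degree contradicts the order at large `k`.
  monomial-∣ᴳ : x ≤ᴳ y → x ∣ᴳ y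
  monomial-∣ᴳ x≤y with ℕₚ.<-cmp m m′
  ... | tri< m<m′ _ _ = let z , z-mono = monomial (m′ ∸ m) (b′ + t) (b + t′) (inj₂ (ℕₚ.m<n⇒0<n∸m m<m′))
                        in quotient (m′ ∸ m) (ℕₚ.m∸n+n≡m (ℕₚ.<⇒≤ m<m′)) z z-mono
  -- For equal degrees the quotient is a constant; the order of the exponents at one `k` shows that
  -- it is a whole power of two.
  ... | tri≈ _ refl _ = let z , z≈ = constant-representable (2 ^ (b′ + t ∸ (b + t′)))
                        in quotient 0 refl z (ev-map (λ k e → trans (cong (2 ^ (b + t′) *_) e)
                             (trans (sym (ℕₚ.^-distribˡ-+-* 2 (b + t′) (b′ + t ∸ (b + t′)))) (cong (2 ^_) (ℕₚ.m+[n∸m]≡n le)))) z≈)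
    where
    le : b + t′ ≤ b′ + t
    le = let k , e = ev-witness (exponents-≤ x≤y) in ℕₚ.+-cancelˡ-≤ (m * k) (b + t′) (b′ + t) e
  ... | tri> _ _ m′<m = ⊥-elim (ev-absurd (λ k e lt → ℕₚ.<⇒≱ (too-big k lt) e) (exponents-≤ x≤y) (ev-≥ (suc (b′ + t))))
    where
    open ℕₚ.≤-Reasoning
    too-big : ∀ k → b′ + t < k → m′ * k + (b′ + t) < m * k + (b + t′)
    too-big k lt = begin-strict
      m′ * k + (b′ + t)    <⟨ ℕₚ.+-monoʳ-< (m′ * k) lt ⟩
      m′ * k + k           ≡⟨ ℕₚ.+-comm (m′ * k) k ⟩
      suc m′ * k           ≤⟨ ℕₚ.*-monoˡ-≤ k m′<m ⟩
      m * k                ≤⟨ ℕₚ.m≤m+n (m * k) (b + t′) ⟩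
      m * k + (b + t′)     ∎

pow₂-∣ᴳ : ∀ x y → Pow₂ x → Pow₂ y → x ≤ᴳ y → x ∣ᴳ y
pow₂-∣ᴳ x y px py x≤y =
  let m , b , t , _ , x-mono = pow₂⇒monomial x px
      m′ , b′ , t′ , _ , y-mono = pow₂⇒monomial y py
  in monomial-∣ᴳ m b t m′ b′ t′ x-mono y-mono x≤y

-- The power of two bounding `2 ^ t * ⟦ a ⟧ k` in `floor-power` becomes the monomial `u` after
-- division by `2 ^ t`, and both bounds survive cancelling that factor.
pow₂-below : ∀ a → Eventually (λ k → 0 < ⟦ a ⟧ k) →
  Σ Germ λ u → Pow₂ u × u ≤ᴳ a × a ≤ᴳ (1ᴳ +ᴳ 1ᴳ) *ᴳ u × a ≢ (1ᴳ +ᴳ 1ᴳ) *ᴳ u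
pow₂-below a a>0 with floor-power a a>0
... | m , b , t , shape , bounds with monomial m b t shape
...   | u , mono = u , monomial⇒pow₂ m b t u mono
      , ev-zip (λ k (lo , _) e → ℕₚ.*-cancelˡ-≤ (2 ^ t) {{2^-nonZero {t}}} (ℕₚ.≤-trans (ℕₚ.≤-reflexive e) lo)) bounds mono
      , ev-map (λ _ → ℕₚ.<⇒≤) below
      , λ eq → ev-absurd (λ k e lt → ℕₚ.<⇒≢ lt e) (≡-germ eq) below
  where
  ⟦2u⟧ : ⟦ (1ᴳ +ᴳ 1ᴳ) *ᴳ u ⟧ ≈ λ k → 2 * ⟦ u ⟧ k
  ⟦2u⟧ = ≈-trans (⟦*⟧ (1ᴳ +ᴳ 1ᴳ) u) (ev-zip (λ k e p → cong (_* ⟦ u ⟧ k) (trans e (cong₂ _+_ p p))) (⟦+⟧ 1ᴳ 1ᴳ) ⟦1⟧)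
  below : Eventually (λ k → ⟦ a ⟧ k < ⟦ (1ᴳ +ᴳ 1ᴳ) *ᴳ u ⟧ k)
  below = ev-zip (λ k (_ , hi) (e , p) → subst (⟦ a ⟧ k <_) (sym e) (ℕₚ.*-cancelˡ-< (2 ^ t) (⟦ a ⟧ k) (2 * ⟦ u ⟧ k)
      (subst (2 ^ t * ⟦ a ⟧ k <_) (trans (cong (2 *_) (sym p)) (swap 2 (2 ^ t) (⟦ u ⟧ k))) hi)))
    bounds (ev-and ⟦2u⟧ mono)
    where
    swap : ∀ a b c → a * (b * c) ≡ b * (a * c)
    swap = solve-∀

-- The axioms in the model

-- The axiom is passed along because the sentence cannot be recovered from the unfolded 𝔊 ⊨ φ.
transfer-axiom : ∀ {φ} → PA⁻smu φ → Universal φ → 𝔑₀ ⊨ φ → 𝔊 ⊨ φ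
transfer-axiom _ = transfer

𝔊-PA⁻smu : 𝔊 ⊨ᵀ PA⁻smu
𝔊-PA⁻smu pa1  = transfer-axiom pa1 (universal {1} (_ ≐ _)) λ x → ℕₚ.+-identityʳ x
-- The innermost quantifier binds `x`, so the arguments arrive in reverse order, here and in the
-- cases below.
𝔊-PA⁻smu pa2  = transfer-axiom pa2 (universal {2} (_ ≐ _)) λ y x → ℕₚ.+-comm x y
𝔊-PA⁻smu pa3  = transfer-axiom pa3 (universal {3} (_ ≐ _)) λ z y x → ℕₚ.+-assoc x y z
𝔊-PA⁻smu pa4  = transfer-axiom pa4 (universal {1} (_ ≐ _)) λ x → ℕₚ.*-identityʳ x
𝔊-PA⁻smu pa5  = transfer-axiom pa5 (universal {2} (_ ≐ _)) λ y x → ℕₚ.*-comm x y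
𝔊-PA⁻smu pa6  = transfer-axiom pa6 (universal {3} (_ ≐ _)) λ z y x → ℕₚ.*-assoc x y z
𝔊-PA⁻smu pa7  = transfer-axiom pa7 (universal {3} (_ ≐ _)) λ z y x → ℕₚ.*-distribˡ-+ x y z
𝔊-PA⁻smu pa8  = transfer-axiom pa8 (universal {2} ((_ ≼ _) ∨′ (_ ≼ _))) λ y x → ℕₚ.≤-total x y
𝔊-PA⁻smu pa9  = transfer-axiom pa9 (universal {3} (((_ ≼ _) ∧′ (_ ≼ _)) ⇒ (_ ≼ _))) λ z y x (p , q) → ℕₚ.≤-trans p q
𝔊-PA⁻smu pa10 = transfer-axiom pa10 (universal {1} ((_ ≼ _) ⇒ ⊥′)) λ x → ℕₚ.m+1+n≰m x
𝔊-PA⁻smu pa11 = transfer-axiom pa11 (universal {2} ((_ ≼ _) ⇒ ((_ ≐ _) ∨′ (_ ≼ _)))) λ y x y≤x →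
  Sum.swap (Sum.map (subst (_≤ x) (ℕₚ.+-comm 1 y)) id (ℕₚ.m≤n⇒m<n∨m≡n y≤x))
𝔊-PA⁻smu pa12 = transfer-axiom pa12 (universal {3} ((_ ≼ _) ⇒ (_ ≼ _))) λ z y x → ℕₚ.+-monoˡ-≤ z
𝔊-PA⁻smu pa13 = transfer-axiom pa13 (universal {3} ((_ ≼ _) ⇒ (_ ≼ _))) λ z y x → ℕₚ.*-monoˡ-≤ z
𝔊-PA⁻smu pa15 = λ y x y≤x → let z , z≈ = ∸-representable y x y≤x in
  z , ≈⇒≡ x (y +ᴳ z) (≈-sym (≈-trans (⟦+⟧ y z)
    (ev-zip (λ k le e → trans (cong (_+_ (⟦ y ⟧ k)) e) (ℕₚ.m+[n∸m]≡n le)) y≤x z≈)))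
𝔊-PA⁻smu pa19 = λ x → pow₂-below (x +ᴳ 1ᴳ) (ev-zip
  (λ k e one → subst (0 <_) (sym (trans e (cong (_+_ (⟦ x ⟧ k)) one))) (ℕₚ.m≤n+m 1 (⟦ x ⟧ k))) (⟦+⟧ x 1ᴳ) ⟦1⟧)
𝔊-PA⁻smu pa20 = λ y x (px , py , x≤y) → pow₂-∣ᴳ x y px py x≤y

-- The residue of X modulo three

eval-numeral : ∀ {n} (ρ : Vec ℕ n) j → eval 𝔑₀ ρ (numeral j) ≡ j
eval-numeral ρ zero          = refl
eval-numeral ρ (suc zero)    = refl
eval-numeral ρ (suc (suc j)) = trans (cong (_+ 1) (eval-numeral ρ (suc j))) (ℕₚ.+-comm (suc j) 1)

¬3∣2^ : ∀ k → ¬ 3 ∣ 2 ^ k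
¬3∣2^ zero    3∣1 = from-no (3 ∣? 1) 3∣1
¬3∣2^ (suc k) 3∣2 with euclidsLemma 2 (2 ^ k) (from-yes (prime? 3)) 3∣2
... | inj₁ 3∣2 = from-no (3 ∣? 2) 3∣2
... | inj₂ 3∣2^k = ¬3∣2^ k 3∣2^k

-- Doubling the equation at `K` and comparing with the one at `suc K` leaves `j` as a difference of
-- multiples of three. Then three divides `2 ^ K`, which is impossible.
2^-not-3a+j : ∀ (f : ℕ → ℕ) j → ¬ Eventually (λ k → 2 ^ k ≡ 3 * f k + j)
2^-not-3a+j f j (from K , eq) = ¬3∣2^ K (subst (3 ∣_) (sym (eq K ℕₚ.≤-refl)) (∣m∣n⇒∣m+n (m∣m*n (f K)) 3∣j))
  where
  open ≡-Reasoning
  double : ∀ a j → 2 * (3 * a + j) ≡ 3 * (2 * a) + j + j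
  double = solve-∀
  3∣j : 3 ∣ j
  3∣j = ∣m+n∣m⇒∣n {3} {3 * (2 * f K)} {j} (divides (f (suc K)) (ℕₚ.+-cancelʳ-≡ j (3 * (2 * f K) + j) (f (suc K) * 3) (begin
    3 * (2 * f K) + j + j   ≡⟨ double (f K) j ⟨
    2 * (3 * f K + j)       ≡⟨ cong (2 *_) (eq K ℕₚ.≤-refl) ⟨
    2 ^ suc K               ≡⟨ eq (suc K) (ℕₚ.n≤1+n K) ⟩
    3 * f (suc K) + j       ≡⟨ cong (_+ j) (ℕₚ.*-comm 3 (f (suc K))) ⟩
    f (suc K) * 3 + j       ∎))) (m∣m*n (2 * f K))

theorem10 : Σ Structure λ 𝔄 →
    (𝔄 ⊨ᵀ PA⁻smu ∪ Th∀ 𝔑₀) ×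
    (Σ (Structure.Carrier 𝔄) λ d →
    (a : Structure.Carrier 𝔄) (j : Fin 3) →
    d ≢ eval 𝔄 (a ∷ []) (numeral 3 ⊗ var 0F ⊕ numeral (toℕ j)))
theorem10 = 𝔊 ,
  (λ { (inj₁ axiom) → 𝔊-PA⁻smu axiom ; (inj₂ (univ , valid)) → transfer univ valid }) ,
  2^ᴳ , λ a j eq → 2^-not-3a+j ⟦ a ⟧ (toℕ j) (≈-trans (≈-sym ⟦2^⟧) (≈-trans (≡-germ eq)
    (ev-map (λ k e → trans e (cong (_+_ (3 * ⟦ a ⟧ k)) (eval-numeral (⟦ a ⟧ k ∷ []) (toℕ j))))
      (⟦eval⟧ (a ∷ []) (numeral 3 ⊗ var 0F ⊕ numeral (toℕ j))))))
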